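{- Let $n\geq 3$ be an integer and let $k_{1}$ and $k_{2}$ be integers such that $1\leq k_{1}<k_{2}\leq\frac{n}{2}$. The accordion graphs $A[n,k_{1}]$ and $A[n,k_{2}]$ are isomorphic if and only if both of the following hold: (i) $\gcd(n,k_{1})=\gcd(n,k_{2})=2$; and (ii) $\frac{k_{1}k_{2}}{2}\equiv\pm2\pmod{n}$.
   Context: For integers $n\geq 3$ and $1\leq k\leq \frac{n}{2}$, the accordion graph $A[n,k]$ is the 4-regular graph with vertex set $\{u_1,\ldots,u_n,v_1,\ldots,v_n\}$ such that $(u_1,u_2,\ldots,u_n)$ and $(v_1,v_2,\ldots,v_n)$ are $n$-cycles, $u_i$ is adjacent to $v_i$ for every $i\in\{1,\ldots,n\}$, and $u_i$ is adjacent to $v_{i+k}$ for every $i\in\{1,\ldots,n\}$, where indices are taken modulo $n$ with residue system $\{1,\ldots,n\}$. -}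

module Defs where

open import Data.Nat using (ℕ; _+_; _*_; _/_; _%_; NonZero)
open import Data.Nat.GCD using (gcd)
open import Data.Fin using (Fin; toℕ)
open import Data.Product using (Σ; _×_; _,_)
open import Data.Sum using (_⊎_)
open import Relation.Binary.PropositionalEquality using (_≡_)
open import Function.Bundles using (_↔_; _⇔_; Inverse)

data Side : Set where
  U V : Side

-- Vertex (U , i) is u_{i+1}, vertex (V , i) is v_{i+1}  (0-based indices mod n).
Vertex : ℕ → Set
Vertex n = Side × Fin n

Adj : (n k : ℕ) → .{{_ : NonZero n}} → Vertex n → Vertex n → Set
Adj n k (U , i) (U , j) = toℕ j ≡ (toℕ i + 1) % n ⊎ toℕ i ≡ (toℕ j + 1) % n
Adj n k (V , i) (V , j) = toℕ j ≡ (toℕ i + 1) % n ⊎ toℕ i ≡ (toℕ j + 1) % n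
Adj n k (U , i) (V , j) = toℕ j ≡ toℕ i ⊎ toℕ j ≡ (toℕ i + k) % n
Adj n k (V , j) (U , i) = toℕ j ≡ toℕ i ⊎ toℕ j ≡ (toℕ i + k) % n

Isomorphic : (n k₁ k₂ : ℕ) → .{{_ : NonZero n}} → Set
Isomorphic n k₁ k₂ =
  Σ (Vertex n ↔ Vertex n) λ f →
    ∀ x y → Adj n k₁ x y ⇔ Adj n k₂ (Inverse.to f x) (Inverse.to f y)

{-# OPTIONS --safe #-}

-- A[n,k] is the Cayley graph of ℤ² / Λ with respect to ± a = (± 1 , 0) and
-- ± b = (0 , ± 1), where Λ is spanned by (n , 0) and (k , 2): the vertices u_i
-- and v_i are the classes of (i , 0) and (i , 1).  If 3 ≤ k and 2k < n, then Λ
-- has no nonzero vector of ℓ¹-norm at most 4, so the only common neighbours of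
-- x + e and x + f, for distinct generators e and f, are x and x + e + f.
-- Hence an isomorphism from A[n,k₁] to A[n,k₂] maps squares to squares and is
-- affine: Φ (i a + j b) = Φ 0 + i c + j d with c, d among ± a, ± b.
-- If c = ± a, comparing the relations k₁ a + 2 b = 0 and k₂ a + 2 b = 0 gives
-- k₁ = k₂; so c = ± b and d = ± a, and the relations n a = 0 and k₁ a + 2 b = 0
-- put (0 , n) and (2 , ± k₁) in the lattice of k₂, which is the arithmetic
-- condition.  Conversely, under
-- that condition (i , j) ↦ (± j , i) induces an isomorphism.  The value
-- k₁ = 1 is excluded by triangles, and k₁ = 2 by counting common neighbours.

module Submission where

open import Defs

module CayleyGraph where

  open import Data.Nat using (ℕ; zero; suc; NonZero; z≤n; s≤s)
  import Data.Nat as ℕ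
  import Data.Nat.Properties as ℕₚ
  import Data.Nat.DivMod as ℕ
  import Data.Nat.Divisibility as ℕ∣
  open import Data.Nat.GCD using (gcd; gcd[m,n]∣m; gcd[m,n]∣n; gcd-greatest)
  open import Data.Integer using (ℤ; +_; -[1+_]; _+_; _-_; _*_; -_; ∣_∣; 0ℤ; 1ℤ; -1ℤ)
  open import Data.Integer.Properties
  open import Data.Integer.DivMod using (_/ℕ_; _%ℕ_; n%ℕd<d; a≡a%ℕn+[a/ℕn]*n)
  open import Data.Integer.Divisibility.Signed
  open import Data.Integer.Tactic.RingSolver using (solve-∀)
  import Data.Sign as Sgn
  open Sgn using (Sign)
  open import Data.Fin using (Fin; toℕ; fromℕ<)
  open import Data.Fin.Properties using (toℕ<n; toℕ-fromℕ<; toℕ-injective)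
  open import Data.Product using (∃; _×_; _,_; proj₁; proj₂)
  open import Data.Product.Properties using (≡-dec)
  open import Data.Sum using (_⊎_; inj₁; inj₂; [_,_]′)
  open import Data.Empty using (⊥-elim)
  open import Function.Base using (_∘_)
  open import Function.Bundles using (mk⇔; mk↔ₛ′; Equivalence; Inverse)
  open import Relation.Nullary using (¬_; Dec; yes; no)
  open import Relation.Nullary.Decidable using (_→-dec_; _⊎-dec_; ¬?; from-yes)
  open import Relation.Binary.PropositionalEquality
  open import Algebra.Properties.CommutativeSemigroup ℕₚ.+-commutativeSemigroup using (interchange)

  -- Residues of naturals as divisibility in ℤ.

  %≡⇒∣ : ∀ n .{{_ : NonZero n}} a b → a ℕ.% n ≡ b ℕ.% n → + n ∣ + a - + b
  %≡⇒∣ n a b eq = divides (+ (a ℕ./ n) - + (b ℕ./ n)) (begin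
    + a - + b
      ≡⟨ cong₂ _-_ (expand a) (trans (expand b) (cong (λ r → + r + + (b ℕ./ n) * + n) (sym eq))) ⟩
    (+ (a ℕ.% n) + + (a ℕ./ n) * + n) - (+ (a ℕ.% n) + + (b ℕ./ n) * + n)
      ≡⟨ identity (+ (a ℕ.% n)) (+ (a ℕ./ n)) (+ (b ℕ./ n)) (+ n) ⟩
    (+ (a ℕ./ n) - + (b ℕ./ n)) * + n ∎)
    where
    open ≡-Reasoning
    expand : ∀ c → + c ≡ + (c ℕ.% n) + + (c ℕ./ n) * + n
    expand c = trans (cong +_ (ℕ.m≡m%n+[m/n]*n c n))
                     (cong (λ z → + (c ℕ.% n) + z) (pos-* (c ℕ./ n) n))
    identity : ∀ r s t m → (r + s * m) - (r + t * m) ≡ (s - t) * m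
    identity = solve-∀

  +-*-injective : ∀ {a b} u n → + a ≡ + b + + u * + n → a ≡ b ℕ.+ u ℕ.* n
  +-*-injective {b = b} u n eq = +-injective (trans eq (cong (λ z → + b + z) (sym (pos-* u n))))

  ∣⇒%≡ : ∀ n .{{_ : NonZero n}} a b → + n ∣ + a - + b → a ℕ.% n ≡ b ℕ.% n
  ∣⇒%≡ n a b (divides (+ u) eq) = trans
    (cong (ℕ._% n) (+-*-injective u n (trans (split (+ a) (+ b)) (cong (λ z → + b + z) eq))))
    (ℕ.[m+kn]%n≡m%n b u n)
    where
    split : ∀ x y → x ≡ y + (x - y)
    split = solve-∀
  -- A negative quotient means that b exceeds a, by u + 1 copies of n, so the two exchange roles.
  ∣⇒%≡ n a b (divides -[1+ u ] eq) = sym (trans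
    (cong (ℕ._% n) (+-*-injective (suc u) n (trans (split (+ a) (+ b)) (trans
      (cong (λ z → + a + - z) eq) (cong (λ z → + a + z) (neg-distribˡ-* -[1+ u ] (+ n)))))))
    (ℕ.[m+kn]%n≡m%n a (suc u) n))
    where
    split : ∀ x y → y ≡ x + - (x - y)
    split = solve-∀

  ∣-small⇒≡0 : ∀ {n z} → + n ∣ z → ∣ z ∣ ℕ.< n → z ≡ 0ℤ
  ∣-small⇒≡0 {n} {z} n∣z z<n with ∣ z ∣ in eq
  ... | zero  = ∣i∣≡0⇒i≡0 eq
  ... | suc r = ⊥-elim (ℕₚ.<⇒≱ z<n (ℕ∣.∣⇒≤ (subst (n ℕ∣.∣_) eq (∣⇒∣ᵤ n∣z))))

  *2≢±1 : ∀ m {z} → z ≡ m * + 2 → ∣ z ∣ ≢ 1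
  *2≢±1 m refl eq with ∣ m ∣ | trans (sym (abs-* m (+ 2))) eq
  ... | zero  | ()
  ... | suc _ | ()

  -- The grid ℤ² and its four unit vectors.

  ℤ² : Set
  ℤ² = ℤ × ℤ

  infixl 6 _⊕_ _⊖_
  infixl 7 _·_

  _⊕_ _⊖_ : ℤ² → ℤ² → ℤ²
  (p , q) ⊕ (p′ , q′) = p + p′ , q + q′
  (p , q) ⊖ (p′ , q′) = p - p′ , q - q′

  _·_ : ℕ → ℤ² → ℤ²
  i · (p , q) = + i * p , + i * q

  𝟎 : ℤ²
  𝟎 = 0ℤ , 0ℤ

  data Dir : Set where
    a⁺ a⁻ b⁺ b⁻ : Dir

  ⟦_⟧ : Dir → ℤ²
  ⟦ a⁺ ⟧ = 1ℤ , 0ℤ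
  ⟦ a⁻ ⟧ = -1ℤ , 0ℤ
  ⟦ b⁺ ⟧ = 0ℤ , 1ℤ
  ⟦ b⁻ ⟧ = 0ℤ , -1ℤ

  opp : Dir → Dir
  opp a⁺ = a⁻
  opp a⁻ = a⁺
  opp b⁺ = b⁻
  opp b⁻ = b⁺

  -- With this, finite facts about sums of unit vectors are settled by evaluation.
  dir? : {P : Dir → Set} → (∀ d → Dec (P d)) → Dec (∀ d → P d)
  dir? P? with P? a⁺ | P? a⁻ | P? b⁺ | P? b⁻
  ... | no ¬p | _     | _     | _     = no λ h → ¬p (h a⁺)
  ... | yes _ | no ¬p | _     | _     = no λ h → ¬p (h a⁻)
  ... | yes _ | yes _ | no ¬p | _     = no λ h → ¬p (h b⁺)
  ... | yes _ | yes _ | yes _ | no ¬p = no λ h → ¬p (h b⁻)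
  ... | yes p | yes q | yes r | yes s = yes λ { a⁺ → p ; a⁻ → q ; b⁺ → r ; b⁻ → s }

  _≟²_ : (u v : ℤ²) → Dec (u ≡ v)
  _≟²_ = ≡-dec _≟_ _≟_

  infix 4 _≟²_

  -- The common-neighbour count of the plane grid: two paths of length two with different first
  -- steps meet at the start or at the fourth corner of a square.
  unit-rhombus : ∀ e f s t → ⟦ e ⟧ ⊕ ⟦ s ⟧ ≡ ⟦ f ⟧ ⊕ ⟦ t ⟧ → ⟦ e ⟧ ≢ ⟦ f ⟧ →
                 ⟦ e ⟧ ⊕ ⟦ s ⟧ ≡ 𝟎 ⊎ ⟦ e ⟧ ⊕ ⟦ s ⟧ ≡ ⟦ e ⟧ ⊕ ⟦ f ⟧
  unit-rhombus = from-yes (dir? λ e → dir? λ f → dir? λ s → dir? λ t →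
    (⟦ e ⟧ ⊕ ⟦ s ⟧ ≟² ⟦ f ⟧ ⊕ ⟦ t ⟧) →-dec (¬? (⟦ e ⟧ ≟² ⟦ f ⟧) →-dec
    ((⟦ e ⟧ ⊕ ⟦ s ⟧ ≟² 𝟎) ⊎-dec (⟦ e ⟧ ⊕ ⟦ s ⟧ ≟² ⟦ e ⟧ ⊕ ⟦ f ⟧))))

  ⟦opp⟧ : ∀ d → ⟦ d ⟧ ⊕ ⟦ opp d ⟧ ≡ 𝟎
  ⟦opp⟧ = from-yes (dir? λ d → ⟦ d ⟧ ⊕ ⟦ opp d ⟧ ≟² 𝟎)

  ⟦opp⟧-≢ : ∀ d → ⟦ d ⟧ ≢ ⟦ opp d ⟧
  ⟦opp⟧-≢ = from-yes (dir? λ d → ¬? (⟦ d ⟧ ≟² ⟦ opp d ⟧))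

  no-unit-triangle : ∀ s t u → ⟦ s ⟧ ⊕ ⟦ t ⟧ ⊕ ⟦ u ⟧ ≢ 𝟎
  no-unit-triangle = from-yes (dir? λ s → dir? λ t → dir? λ u → ¬? (⟦ s ⟧ ⊕ ⟦ t ⟧ ⊕ ⟦ u ⟧ ≟² 𝟎))

  ‖_‖ : ℤ² → ℕ
  ‖ p , q ‖ = ∣ p ∣ ℕ.+ ∣ q ∣

  ‖⟦⟧‖ : ∀ d → ‖ ⟦ d ⟧ ‖ ≡ 1
  ‖⟦⟧‖ = from-yes (dir? λ d → ‖ ⟦ d ⟧ ‖ ℕ.≟ 1)

  ‖⊕‖ : ∀ u v → ‖ u ⊕ v ‖ ℕ.≤ ‖ u ‖ ℕ.+ ‖ v ‖
  ‖⊕‖ (p , q) (p′ , q′) = ℕₚ.≤-trans (ℕₚ.+-mono-≤ (∣i+j∣≤∣i∣+∣j∣ p p′) (∣i+j∣≤∣i∣+∣j∣ q q′))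
    (ℕₚ.≤-reflexive (interchange (∣ p ∣) (∣ p′ ∣) (∣ q ∣) (∣ q′ ∣)))

  ‖⊖‖ : ∀ u v → ‖ u ⊖ v ‖ ℕ.≤ ‖ u ‖ ℕ.+ ‖ v ‖
  ‖⊖‖ (p , q) (p′ , q′) = ℕₚ.≤-trans (ℕₚ.+-mono-≤ (∣i-j∣≤∣i∣+∣j∣ p p′) (∣i-j∣≤∣i∣+∣j∣ q q′))
    (ℕₚ.≤-reflexive (interchange (∣ p ∣) (∣ p′ ∣) (∣ q ∣) (∣ q′ ∣)))

  ‖⟦⟧⊕⟦⟧‖ : ∀ s t → ‖ ⟦ s ⟧ ⊕ ⟦ t ⟧ ‖ ℕ.≤ 2
  ‖⟦⟧⊕⟦⟧‖ s t =
    ℕₚ.≤-trans (‖⊕‖ ⟦ s ⟧ ⟦ t ⟧) (ℕₚ.≤-reflexive (cong₂ ℕ._+_ (‖⟦⟧‖ s) (‖⟦⟧‖ t)))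

  ⊖≡𝟎⇒≡ : ∀ {u v} → u ⊖ v ≡ 𝟎 → u ≡ v
  ⊖≡𝟎⇒≡ {p , q} {p′ , q′} eq =
    cong₂ _,_ (i-j≡0⇒i≡j p p′ (cong proj₁ eq)) (i-j≡0⇒i≡j q q′ (cong proj₂ eq))

  -- The lattice Λ and adjacency modulo Λ.

  module Accordion (n : ℕ) .{{_ : NonZero n}} where

    -- The lattice spanned by (n , 0) and (k , 2).
    record Λ (k : ℕ) (v : ℤ²) : Set where
      constructor lattice
      field
        half : ℤ
        even : proj₂ v ≡ half * + 2
        rest : + n ∣ proj₁ v - half * + k

    infix 4 _≈[_]_

    -- A record, not a synonym, because x and y cannot be recovered from `x ⊖ y` by unification.
    record _≈[_]_ (x : ℤ²) (k : ℕ) (y : ℤ²) : Set where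
      constructor modΛ
      field difference : Λ k (x ⊖ y)

    record Adjacent (k : ℕ) (x y : ℤ²) : Set where
      constructor edge
      field
        direction : Dir
        along     : y ≈[ k ] x ⊕ ⟦ direction ⟧

    module _ {k : ℕ} where

      Λ-⊕ : ∀ {u v} → Λ k u → Λ k v → Λ k (u ⊕ v)
      Λ-⊕ {p , _} {p′ , _} (lattice m e r) (lattice m′ e′ r′) = lattice (m + m′)
        (trans (cong₂ _+_ e e′) (sym (*-distribʳ-+ (+ 2) m m′)))
        (subst (+ n ∣_) (identity p p′ m m′ (+ k)) (∣m∣n⇒∣m+n r r′))
        where
        identity : ∀ p p′ m m′ k → (p - m * k) + (p′ - m′ * k) ≡ (p + p′) - (m + m′) * k
        identity = solve-∀

      Λ-⊖ : ∀ {u v} → Λ k u → Λ k v → Λ k (u ⊖ v)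
      Λ-⊖ {p , _} {p′ , _} (lattice m e r) (lattice m′ e′ r′) = lattice (m - m′)
        (trans (cong₂ _-_ e e′) (double m m′))
        (subst (+ n ∣_) (identity p p′ m m′ (+ k)) (∣m∣n⇒∣m-n r r′))
        where
        double : ∀ m m′ → m * + 2 - m′ * + 2 ≡ (m - m′) * + 2
        double = solve-∀
        identity : ∀ p p′ m m′ k → (p - m * k) - (p′ - m′ * k) ≡ (p - p′) - (m - m′) * k
        identity = solve-∀

      Λ-𝟎 : Λ k 𝟎
      Λ-𝟎 = lattice 0ℤ refl (divides 0ℤ refl)

      -- Cancelling 2 shows that the second coordinate determines the coefficient of (k , 2).
      Λ-at : ∀ m {p} → Λ k (p , m * + 2) → + n ∣ p - m * + k
      Λ-at m {p} (lattice m′ e r) =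
        subst (λ z → + n ∣ p - z * + k) (*-cancelʳ-≡ m′ m (+ 2) (sym e)) r

      Λ-odd : ∀ {p q} → ∣ q ∣ ≡ 1 → ¬ Λ k (p , q)
      Λ-odd odd (lattice m e _) = *2≢±1 m e odd

    module _ {k : ℕ} where

      Λ-intro : ∀ m {p z} → + n ∣ z → z ≡ p - m * + k → Λ k (p , m * + 2)
      Λ-intro m n∣z eq = lattice m refl (subst (+ n ∣_) eq n∣z)

      Λ-elim : ∀ m {p z} → Λ k (p , m * + 2) → p - m * + k ≡ z → + n ∣ z
      Λ-elim m l eq = subst (+ n ∣_) eq (Λ-at m l)

    fin-≡ : {i j : Fin n} → + n ∣ + toℕ i - + toℕ j → toℕ i ≡ toℕ j
    fin-≡ {i} {j} n∣i-j = begin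
      toℕ i        ≡⟨ ℕ.m<n⇒m%n≡m (toℕ<n i) ⟨
      toℕ i ℕ.% n  ≡⟨ ∣⇒%≡ n (toℕ i) (toℕ j) n∣i-j ⟩
      toℕ j ℕ.% n  ≡⟨ ℕ.m<n⇒m%n≡m (toℕ<n j) ⟩
      toℕ j        ∎
      where open ≡-Reasoning

    ≡⇒∣ : {i j : Fin n} → toℕ i ≡ toℕ j → + n ∣ + toℕ i - + toℕ j
    ≡⇒∣ {i} {j} eq = %≡⇒∣ n (toℕ i) (toℕ j) (cong (ℕ._% n) eq)

    shift⇒∣ : {i : Fin n} {s : ℕ} → toℕ i ≡ s ℕ.% n → + n ∣ + toℕ i - + s
    shift⇒∣ {i} {s} eq = %≡⇒∣ n (toℕ i) s (trans (ℕ.m<n⇒m%n≡m (toℕ<n i)) eq)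

    ∣⇒shift : {i : Fin n} {s : ℕ} → + n ∣ + toℕ i - + s → toℕ i ≡ s ℕ.% n
    ∣⇒shift {i} {s} n∣i-s = trans (sym (ℕ.m<n⇒m%n≡m (toℕ<n i))) (∣⇒%≡ n (toℕ i) s n∣i-s)

    -- Vertices as classes of ℤ² modulo Λ.

    rep : Vertex n → ℤ²
    rep (U , i) = + toℕ i , 0ℤ
    rep (V , i) = + toℕ i , 1ℤ

    side : ℕ → Side
    side zero    = U
    side (suc _) = V

    -- The normal form of a class: removing `j /ℕ 2` copies of (k , 2) leaves height 0 or 1, and
    -- copies of (n , 0) then bring the first coordinate into range.
    point : ℕ → ℤ² → Vertex n
    point k (i , j) = side (j %ℕ 2) , fromℕ< (n%ℕd<d (i - (j /ℕ 2) * + k) n)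

    rep-side : ∀ {r} (i : Fin n) → r ℕ.< 2 → rep (side r , i) ≡ (+ toℕ i , + r)
    rep-side {0} i _ = refl
    rep-side {1} i _ = refl
    rep-side {suc (suc _)} i (s≤s (s≤s ()))

    rep-point : ∀ k v → v ≈[ k ] rep (point k v)
    rep-point k v@(i , j) = subst (v ≈[ k ]_) (sym rep≡) (modΛ (lattice m
      (trans (cong (_- + (j %ℕ 2)) (a≡a%ℕn+[a/ℕn]*n j 2)) (drop (+ (j %ℕ 2)) (m * + 2)))
      (divides (z /ℕ n) (trans (reorder i (+ (z %ℕ n)) (m * + k))
        (trans (cong (_- + (z %ℕ n)) (a≡a%ℕn+[a/ℕn]*n z n)) (drop (+ (z %ℕ n)) _))))))
      where
      m = j /ℕ 2
      z = i - m * + k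
      drop : ∀ r s → (r + s) - r ≡ s
      drop = solve-∀
      reorder : ∀ x y w → (x - y) - w ≡ (x - w) - y
      reorder = solve-∀
      rep≡ : rep (point k v) ≡ (+ (z %ℕ n) , + (j %ℕ 2))
      rep≡ = trans (rep-side _ (n%ℕd<d j 2)) (cong (λ r → + r , + (j %ℕ 2)) (toℕ-fromℕ< _))

    rep-injective : ∀ k x y → rep x ≈[ k ] rep y → x ≡ y
    rep-injective k (U , i) (U , j) (modΛ l) =
      cong (U ,_) (toℕ-injective (fin-≡ (Λ-elim 0ℤ l (+-identityʳ _))))
    rep-injective k (V , i) (V , j) (modΛ l) =
      cong (V ,_) (toℕ-injective (fin-≡ (Λ-elim 0ℤ l (+-identityʳ _))))
    rep-injective k (U , i) (V , j) (modΛ l) = ⊥-elim (Λ-odd refl l)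
    rep-injective k (V , i) (U , j) (modΛ l) = ⊥-elim (Λ-odd refl l)

    private
      forward : ∀ i j k → j - (i + 1ℤ) ≡ j - (i + 1ℤ) - 0ℤ * k
      forward = solve-∀
      backward : ∀ i j k → - (i - (j + 1ℤ)) ≡ j - (i + -1ℤ) - 0ℤ * k
      backward = solve-∀
      backward′ : ∀ i j k → - (j - (i + -1ℤ) - 0ℤ * k) ≡ i - (j + 1ℤ)
      backward′ = solve-∀
      spoke : ∀ i j k → j - i ≡ j - (i + 0ℤ) - 0ℤ * k
      spoke = solve-∀
      slant : ∀ i j k → j - (i + k) ≡ j - (i + 0ℤ) - 1ℤ * k
      slant = solve-∀
      spoke⁻ : ∀ i j k → - (j - i) ≡ i - (j + 0ℤ) - 0ℤ * k
      spoke⁻ = solve-∀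
      slant⁻ : ∀ i j k → - (j - (i + k)) ≡ i - (j + 0ℤ) - -1ℤ * k
      slant⁻ = solve-∀
      spoke′ : ∀ i j k → - (i - (j + 0ℤ) - 0ℤ * k) ≡ j - i
      spoke′ = solve-∀
      slant′ : ∀ i j k → - (i - (j + 0ℤ) - -1ℤ * k) ≡ j - (i + k)
      slant′ = solve-∀

    -- The edge from u_i to v_{i+k} is a step `b⁻`, because (i + k , 1) and (i , -1) differ by (k ,
    -- 2). Hence the lattice coefficient is 1 on this edge, -1 on its reverse and 0 on all others.
    Adj⇒Adjacent : ∀ k x y → Adj n k x y → Adjacent k (rep x) (rep y)
    Adj⇒Adjacent k (U , i) (U , j) (inj₁ e) =
      edge a⁺ (modΛ (Λ-intro 0ℤ (shift⇒∣ e) (forward (+ toℕ i) (+ toℕ j) (+ k))))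
    Adj⇒Adjacent k (U , i) (U , j) (inj₂ e) =
      edge a⁻ (modΛ (Λ-intro 0ℤ (∣m⇒∣-m (shift⇒∣ e)) (backward (+ toℕ i) (+ toℕ j) (+ k))))
    Adj⇒Adjacent k (V , i) (V , j) (inj₁ e) =
      edge a⁺ (modΛ (Λ-intro 0ℤ (shift⇒∣ e) (forward (+ toℕ i) (+ toℕ j) (+ k))))
    Adj⇒Adjacent k (V , i) (V , j) (inj₂ e) =
      edge a⁻ (modΛ (Λ-intro 0ℤ (∣m⇒∣-m (shift⇒∣ e)) (backward (+ toℕ i) (+ toℕ j) (+ k))))
    Adj⇒Adjacent k (U , i) (V , j) (inj₁ e) =
      edge b⁺ (modΛ (Λ-intro 0ℤ (≡⇒∣ e) (spoke (+ toℕ i) (+ toℕ j) (+ k))))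
    Adj⇒Adjacent k (U , i) (V , j) (inj₂ e) =
      edge b⁻ (modΛ (Λ-intro 1ℤ (shift⇒∣ e) (slant (+ toℕ i) (+ toℕ j) (+ k))))
    Adj⇒Adjacent k (V , j) (U , i) (inj₁ e) =
      edge b⁻ (modΛ (Λ-intro 0ℤ (∣m⇒∣-m (≡⇒∣ e)) (spoke⁻ (+ toℕ i) (+ toℕ j) (+ k))))
    Adj⇒Adjacent k (V , j) (U , i) (inj₂ e) =
      edge b⁺ (modΛ (Λ-intro -1ℤ (∣m⇒∣-m (shift⇒∣ e)) (slant⁻ (+ toℕ i) (+ toℕ j) (+ k))))

    Adjacent⇒Adj : ∀ k x y → Adjacent k (rep x) (rep y) → Adj n k x y
    Adjacent⇒Adj k (U , i) (U , j) (edge a⁺ (modΛ l)) =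
      inj₁ (∣⇒shift (Λ-elim 0ℤ l (sym (forward (+ toℕ i) (+ toℕ j) (+ k)))))
    Adjacent⇒Adj k (U , i) (U , j) (edge a⁻ (modΛ l)) =
      inj₂ (∣⇒shift (subst (+ n ∣_) (backward′ (+ toℕ i) (+ toℕ j) (+ k)) (∣m⇒∣-m (Λ-at 0ℤ l))))
    Adjacent⇒Adj k (V , i) (V , j) (edge a⁺ (modΛ l)) =
      inj₁ (∣⇒shift (Λ-elim 0ℤ l (sym (forward (+ toℕ i) (+ toℕ j) (+ k)))))
    Adjacent⇒Adj k (V , i) (V , j) (edge a⁻ (modΛ l)) =
      inj₂ (∣⇒shift (subst (+ n ∣_) (backward′ (+ toℕ i) (+ toℕ j) (+ k)) (∣m⇒∣-m (Λ-at 0ℤ l))))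
    Adjacent⇒Adj k (U , i) (V , j) (edge b⁺ (modΛ l)) =
      inj₁ (fin-≡ (Λ-elim 0ℤ l (sym (spoke (+ toℕ i) (+ toℕ j) (+ k)))))
    Adjacent⇒Adj k (U , i) (V , j) (edge b⁻ (modΛ l)) =
      inj₂ (∣⇒shift (Λ-elim 1ℤ l (sym (slant (+ toℕ i) (+ toℕ j) (+ k)))))
    Adjacent⇒Adj k (V , j) (U , i) (edge b⁻ (modΛ l)) =
      inj₁ (fin-≡ (subst (+ n ∣_) (spoke′ (+ toℕ i) (+ toℕ j) (+ k)) (∣m⇒∣-m (Λ-at 0ℤ l))))
    Adjacent⇒Adj k (V , j) (U , i) (edge b⁺ (modΛ l)) =
      inj₂ (∣⇒shift (subst (+ n ∣_) (slant′ (+ toℕ i) (+ toℕ j) (+ k)) (∣m⇒∣-m (Λ-at -1ℤ l))))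
    -- A vertical step changes the parity of the height and a horizontal one keeps it, so every
    -- remaining case puts an odd height into Λ.
    Adjacent⇒Adj k (U , _) (U , _) (edge b⁺ (modΛ l)) = ⊥-elim (Λ-odd refl l)
    Adjacent⇒Adj k (U , _) (U , _) (edge b⁻ (modΛ l)) = ⊥-elim (Λ-odd refl l)
    Adjacent⇒Adj k (V , _) (V , _) (edge b⁺ (modΛ l)) = ⊥-elim (Λ-odd refl l)
    Adjacent⇒Adj k (V , _) (V , _) (edge b⁻ (modΛ l)) = ⊥-elim (Λ-odd refl l)
    Adjacent⇒Adj k (U , _) (V , _) (edge a⁺ (modΛ l)) = ⊥-elim (Λ-odd refl l)
    Adjacent⇒Adj k (U , _) (V , _) (edge a⁻ (modΛ l)) = ⊥-elim (Λ-odd refl l)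
    Adjacent⇒Adj k (V , _) (U , _) (edge a⁺ (modΛ l)) = ⊥-elim (Λ-odd refl l)
    Adjacent⇒Adj k (V , _) (U , _) (edge a⁻ (modΛ l)) = ⊥-elim (Λ-odd refl l)

    -- Congruence modulo Λ.

    module _ {k : ℕ} where

      Λ⇒≈ : ∀ {v x y} → Λ k v → v ≡ x ⊖ y → x ≈[ k ] y
      Λ⇒≈ l eq = modΛ (subst (Λ k) eq l)

      ≈-refl : ∀ x → x ≈[ k ] x
      ≈-refl (p , q) = Λ⇒≈ Λ-𝟎 (sym (cong₂ _,_ (+-inverseʳ p) (+-inverseʳ q)))

      ≈-reflexive : ∀ {x y} → x ≡ y → x ≈[ k ] y
      ≈-reflexive {x} refl = ≈-refl x

      ≈-sym : ∀ {x y} → x ≈[ k ] y → y ≈[ k ] x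
      ≈-sym {p , q} {p′ , q′} (modΛ l) =
        Λ⇒≈ (Λ-⊖ Λ-𝟎 l) (cong₂ _,_ (identity p p′) (identity q q′))
        where
        identity : ∀ x y → 0ℤ - (x - y) ≡ y - x
        identity = solve-∀

      ≈-trans : ∀ {x y z} → x ≈[ k ] y → y ≈[ k ] z → x ≈[ k ] z
      ≈-trans {p , q} {p′ , q′} {p″ , q″} (modΛ l) (modΛ l′) =
        Λ⇒≈ (Λ-⊕ l l′) (cong₂ _,_ (identity p p′ p″) (identity q q′ q″))
        where
        identity : ∀ x y z → (x - y) + (y - z) ≡ x - z
        identity = solve-∀

      ⊕-cong : ∀ {x y u v} → x ≈[ k ] y → u ≈[ k ] v → x ⊕ u ≈[ k ] y ⊕ v
      ⊕-cong {p , q} {p′ , q′} {r , s} {r′ , s′} (modΛ l) (modΛ l′) =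
        Λ⇒≈ (Λ-⊕ l l′) (cong₂ _,_ (identity p p′ r r′) (identity q q′ s s′))
        where
        identity : ∀ x y u v → (x - y) + (u - v) ≡ (x + u) - (y + v)
        identity = solve-∀

      ⊖-cong : ∀ {x y u v} → x ≈[ k ] y → u ≈[ k ] v → x ⊖ u ≈[ k ] y ⊖ v
      ⊖-cong {p , q} {p′ , q′} {r , s} {r′ , s′} (modΛ l) (modΛ l′) =
        Λ⇒≈ (Λ-⊖ l l′) (cong₂ _,_ (identity p p′ r r′) (identity q q′ s s′))
        where
        identity : ∀ x y u v → (x - y) - (u - v) ≡ (x - u) - (y - v)
        identity = solve-∀

      Adjacent-resp : ∀ {x x′ y y′} → x ≈[ k ] x′ → y ≈[ k ] y′ →
                      Adjacent k x y → Adjacent k x′ y′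
      Adjacent-resp x≈x′ y≈y′ (edge s l) =
        edge s (≈-trans (≈-sym y≈y′) (≈-trans l (⊕-cong x≈x′ (≈-refl ⟦ s ⟧))))

      point-cong : ∀ {x y} → x ≈[ k ] y → point k x ≡ point k y
      point-cong {x} {y} l = rep-injective k (point k x) (point k y)
        (≈-trans (≈-sym (rep-point k x))
          (≈-trans l (rep-point k y)))

      point-injective : ∀ {x y} → point k x ≡ point k y → x ≈[ k ] y
      point-injective {x} {y} eq = ≈-trans (rep-point k x)
        (subst (λ v → rep v ≈[ k ] y) (sym eq) (≈-sym (rep-point k y)))

      point-rep : ∀ v → point k (rep v) ≡ v
      point-rep v = rep-injective k _ v (≈-sym (rep-point k (rep v)))

    -- Lifting isomorphisms to ℤ² and descending them.

    -- An isomorphism of the accordion graphs, lifted to representatives in ℤ².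
    record Lift (k₁ k₂ : ℕ) : Set where
      field
        to from   : ℤ² → ℤ²
        to-cong   : ∀ {x y} → x ≈[ k₁ ] y → to x ≈[ k₂ ] to y
        injective : ∀ {x y} → to x ≈[ k₂ ] to y → x ≈[ k₁ ] y
        to-from   : ∀ y → to (from y) ≈[ k₂ ] y
        adj-to    : ∀ {x y} → Adjacent k₁ x y → Adjacent k₂ (to x) (to y)
        adj-from  : ∀ {x y} → Adjacent k₂ (to x) (to y) → Adjacent k₁ x y

      from-to : ∀ x → from (to x) ≈[ k₁ ] x
      from-to x = injective (to-from (to x))

      from-cong : ∀ {x y} → x ≈[ k₂ ] y → from x ≈[ k₁ ] from y
      from-cong {x} {y} l = injective (≈-trans (to-from x)
        (≈-trans l (≈-sym (to-from y))))

    Lift-sym : ∀ {k₁ k₂} → Lift k₁ k₂ → Lift k₂ k₁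
    Lift-sym φ = record
      { to        = from
      ; from      = to
      ; to-cong   = from-cong
      ; injective = λ {x} {y} l → ≈-trans (≈-sym (to-from x))
                      (≈-trans (to-cong l) (to-from y))
      ; to-from   = from-to
      ; adj-to    = λ {x} {y} → adj-from ∘
                      Adjacent-resp (≈-sym (to-from x))
                                                    (≈-sym (to-from y))
      ; adj-from  = λ {x} {y} → Adjacent-resp (to-from x) (to-from y)
                      ∘ adj-to
      }
      where open Lift φ

    lift : ∀ {k₁ k₂} → Isomorphic n k₁ k₂ → Lift k₁ k₂
    lift {k₁} {k₂} (f , f-adj) = record
      { to        = λ x → rep (f.to (point k₁ x))
      ; from      = λ y → rep (f.from (point k₂ y))
      ; to-cong   = ≈-reflexive ∘ cong (rep ∘ f.to) ∘ point-cong
      ; injective = λ {x} {y} l → point-injective {x = x} {y = y} (f-injective (rep-injective k₂ _ _ l))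
      ; to-from   = λ y → subst (λ v → rep v ≈[ k₂ ] y)
                      (sym (trans (cong f.to (point-rep _)) (f.strictlyInverseˡ (point k₂ y))))
                      (≈-sym (rep-point k₂ y))
      ; adj-to    = λ {x} {y} h → Adj⇒Adjacent k₂ _ _ (Equivalence.to (f-adj _ _)
                      (Adjacent⇒Adj k₁ _ _ (Adjacent-resp (rep-point k₁ x) (rep-point k₁ y) h)))
      ; adj-from  = λ {x} {y} h → Adjacent-resp {y = rep (point k₁ y)}
                      (≈-sym (rep-point k₁ x)) (≈-sym (rep-point k₁ y))
                      (Adj⇒Adjacent k₁ _ _ (Equivalence.from (f-adj _ _) (Adjacent⇒Adj k₂ _ _ h)))
      }
      where
      module f = Inverse f
      f-injective : ∀ {v w} → f.to v ≡ f.to w → v ≡ w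
      f-injective eq = trans (sym (f.strictlyInverseʳ _)) (trans (cong f.from eq) (f.strictlyInverseʳ _))

    descend : ∀ {k₁ k₂} → Lift k₁ k₂ → Isomorphic n k₁ k₂
    descend {k₁} {k₂} φ = mk↔ₛ′ (descended φ) (descended (Lift-sym φ))
                                (descended-inverse φ) (descended-inverse (Lift-sym φ))
      , λ x y → mk⇔
        (λ h → Adjacent⇒Adj k₂ _ _ (Adjacent-resp {y = to (rep y)}
                 (rep-point k₂ _) (rep-point k₂ _) (adj-to (Adj⇒Adjacent k₁ x y h))))
        (λ h → Adjacent⇒Adj k₁ x y (adj-from (Adjacent-resp
                 {x = rep (point k₂ (to (rep x)))} {y = rep (point k₂ (to (rep y)))}
                 (≈-sym (rep-point k₂ _)) (≈-sym (rep-point k₂ _))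
                 (Adj⇒Adjacent k₂ _ _ h))))
      where
      open Lift φ
      descended : ∀ {k₁ k₂} → Lift k₁ k₂ → Vertex n → Vertex n
      descended {k₂ = k₂} ψ x = point k₂ (Lift.to ψ (rep x))
      descended-inverse : ∀ {k₁ k₂} (ψ : Lift k₁ k₂) y →
                          descended ψ (descended (Lift-sym ψ) y) ≡ y
      descended-inverse {k₁} {k₂} ψ y = trans
        (point-cong (≈-trans {y = ψ.to x}
          (ψ.to-cong (≈-sym (rep-point k₁ x))) (ψ.to-from (rep y))))
        (point-rep y)
        where
        module ψ = Lift ψ
        x = ψ.from (rep y)

    -- The arithmetic condition in terms of lattices.

    gcd≡2 : ∀ {m k} → 2 ℕ∣.∣ m → 2 ℕ∣.∣ k → (∀ {d} → d ℕ∣.∣ m → d ℕ∣.∣ k → d ℕ∣.∣ 2) → gcd m k ≡ 2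
    gcd≡2 {m} {k} 2∣m 2∣k d∣2 =
      ℕ∣.∣-antisym (d∣2 (gcd[m,n]∣m m k) (gcd[m,n]∣n m k)) (gcd-greatest 2∣m 2∣k)

    -- `ε` is the sign in k₁ k₂ / 2 ≡ ± 2. The division in ℕ is exact because `gcd₁` makes k₁ even.
    record Arithmetic (ε : ℤ) (k₁ k₂ : ℕ) : Set where
      constructor arithmetic
      field
        gcd₁   : gcd n k₁ ≡ 2
        gcd₂   : gcd n k₂ ≡ 2
        n∣half : + n ∣ + (k₁ ℕ.* k₂ ℕ./ 2) - ε * + 2

    -- Λ k₂ contains the images of (n , 0) and (k₁ , 2) under the quarter turn or
    -- reflection (i , j) ↦ (ε j , i).
    record Turn (ε : ℤ) (k₁ k₂ : ℕ) : Set where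
      constructor turn
      field
        closes  : Λ k₂ (0ℤ , + n)
        rotates : Λ k₂ (+ 2 , ε * + k₁)

    half-* : ∀ j k → j ℕ.* 2 ℕ.* k ℕ./ 2 ≡ j ℕ.* k
    half-* j k = trans (cong (ℕ._/ 2) (begin
      j ℕ.* 2 ℕ.* k    ≡⟨ ℕₚ.*-assoc j 2 k ⟩
      j ℕ.* (2 ℕ.* k)  ≡⟨ cong (j ℕ.*_) (ℕₚ.*-comm 2 k) ⟩
      j ℕ.* (k ℕ.* 2)  ≡⟨ ℕₚ.*-assoc j k 2 ⟨
      j ℕ.* k ℕ.* 2    ∎)) (ℕ.m*n/n≡m (j ℕ.* k) 2)
      where open ≡-Reasoning

    module _ {ε : ℤ} (ε²≡1 : ε * ε ≡ 1ℤ) where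

      -- Write n = 2 n′, k₁ = 2 j, k₂ = 2 l. Then (0 , n) = n′ (k₂ , 2) - l (n , 0), and multiplying
      -- j k₂ ≡ 2 ε by ε shows that (2 , ε k₁) is ε j (k₂ , 2) modulo (n , 0).
      arithmetic⇒turn : ∀ {k₁ k₂} → Arithmetic ε k₁ k₂ → Turn ε k₁ k₂
      arithmetic⇒turn {k₁} {k₂} (arithmetic gcd₁ gcd₂ n∣half)
        with subst (ℕ∣._∣ k₁) gcd₁ (gcd[m,n]∣n n k₁)
           | subst (ℕ∣._∣ k₂) gcd₂ (gcd[m,n]∣n n k₂)
           | subst (ℕ∣._∣ n) gcd₁ (gcd[m,n]∣m n k₁)
      ... | ℕ∣.divides j refl | ℕ∣.divides l refl | ℕ∣.divides n′ n≡n′*2 = turn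
        (lattice (+ n′) +n≡ (divides (- + l) (begin
          0ℤ - + n′ * + (l ℕ.* 2)    ≡⟨ cong (λ z → 0ℤ - + n′ * z) (pos-* l 2) ⟩
          0ℤ - + n′ * (+ l * + 2)    ≡⟨ reassociate (+ n′) (+ l) (+ 2) ⟩
          - + l * (+ n′ * + 2)       ≡⟨ cong (- + l *_) +n≡ ⟨
          - + l * + n                ∎)))
        (lattice (ε * + j) (trans (cong (ε *_) (pos-* j 2)) (sym (*-assoc ε (+ j) (+ 2))))
          (subst (+ n ∣_) (begin
            - ε * (+ j * + k₂ - ε * + 2)      ≡⟨ expand ε (+ j) (+ k₂) (+ 2) ⟩
            (ε * ε) * + 2 - ε * + j * + k₂    ≡⟨ cong (λ z → z * + 2 - ε * + j * + k₂) ε²≡1 ⟩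
            + 2 - ε * + j * + k₂              ∎)
            (∣n⇒∣m*n (- ε) (subst (λ z → + n ∣ z - ε * + 2)
              (trans (cong +_ (half-* j k₂)) (pos-* j k₂)) n∣half))))
        where
        open ≡-Reasoning
        +n≡ : + n ≡ + n′ * + 2
        +n≡ = trans (cong +_ n≡n′*2) (pos-* n′ 2)
        reassociate : ∀ x y z → 0ℤ - x * (y * z) ≡ - y * (x * z)
        reassociate = solve-∀
        expand : ∀ e x y z → - e * (x * y - e * z) ≡ (e * e) * z - e * x * y
        expand = solve-∀

      -- `closes` makes n and k₂ even; `rotates` makes k₁ even and gives m k₂ ≡ 2 modulo n, where ε
      -- m = k₁ / 2. A common divisor of n and k₁ or k₂ then divides m k₂ and so 2.
      turn⇒arithmetic : ∀ {k₁ k₂} → Turn ε k₁ k₂ → Arithmetic ε k₁ k₂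
      turn⇒arithmetic {k₁} {k₂} (turn (lattice n′ +n≡n′*2 (divides t 0-n′k₂≡tn)) (lattice m εk₁≡m*2 n∣2-mk₂)) =
        arithmetic
          (gcd≡2 (∣⇒∣ᵤ 2∣n) (∣⇒∣ᵤ 2∣k₁) λ d∣n d∣k₁ → divides-2 d∣n
            -- With k₁ = 2 ε m and k₂ = 2 l, the multiple l k₁ equals ε m k₂.
            (subst (_ ∣_) (trans (cong (l *_) +k₁≡) (trans (reassociate l (ε * m) (+ 2)) (cong (ε * m *_) (sym +k₂≡))))
              (∣n⇒∣m*n l (∣ᵤ⇒∣ d∣k₁))))
          (gcd≡2 (∣⇒∣ᵤ 2∣n) (∣⇒∣ᵤ 2∣k₂) λ d∣n d∣k₂ → divides-2 d∣n (∣n⇒∣m*n (ε * m) (∣ᵤ⇒∣ d∣k₂)))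
          (subst (+ n ∣_) (begin
            - ε * (+ 2 - m * + k₂)       ≡⟨ expand ε m (+ k₂) (+ 2) ⟩
            ε * m * + k₂ - ε * + 2       ≡⟨ cong (_- ε * + 2) half≡ ⟨
            + (k₁ ℕ.* k₂ ℕ./ 2) - ε * + 2  ∎)
            (∣n⇒∣m*n (- ε) n∣2-mk₂))
        where
        open ≡-Reasoning
        l = - t
        instance
          +n≢0 : Data.Integer.NonZero (+ n)
          +n≢0 = ℕ.≢-nonZero (ℕ.≢-nonZero⁻¹ n)
        reassociate : ∀ x y z → x * (y * z) ≡ y * (x * z)
        reassociate = solve-∀
        expand : ∀ e x y z → - e * (z - x * y) ≡ e * x * y - e * z
        expand = solve-∀
        +k₁≡ : + k₁ ≡ (ε * m) * + 2
        +k₁≡ = begin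
          + k₁               ≡⟨ *-identityˡ (+ k₁) ⟨
          1ℤ * + k₁          ≡⟨ cong (_* + k₁) ε²≡1 ⟨
          ε * ε * + k₁       ≡⟨ *-assoc ε ε (+ k₁) ⟩
          ε * (ε * + k₁)     ≡⟨ cong (ε *_) εk₁≡m*2 ⟩
          ε * (m * + 2)      ≡⟨ *-assoc ε m (+ 2) ⟨
          ε * m * + 2        ∎
        -- Doubling - n′ k₂ = t n gives k₂ n = - 2 t n, from which n cancels.
        +k₂≡ : + k₂ ≡ l * + 2
        +k₂≡ = *-cancelʳ-≡ (+ k₂) (l * + 2) (+ n) (begin
          + k₂ * + n                       ≡⟨ cong (+ k₂ *_) +n≡n′*2 ⟩
          + k₂ * (n′ * + 2)                ≡⟨ regroup (+ k₂) n′ (+ 2) ⟩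
          - (0ℤ - n′ * + k₂) * + 2         ≡⟨ cong (λ z → - z * + 2) 0-n′k₂≡tn ⟩
          - (t * + n) * + 2                ≡⟨ regroup′ t (+ n) (+ 2) ⟩
          - t * + 2 * + n                  ∎)
          where
          regroup : ∀ x y z → x * (y * z) ≡ - (0ℤ - y * x) * z
          regroup = solve-∀
          regroup′ : ∀ x y z → - (x * y) * z ≡ - x * z * y
          regroup′ = solve-∀
        2∣n : + 2 ∣ + n
        2∣n = divides n′ +n≡n′*2
        2∣k₁ : + 2 ∣ + k₁
        2∣k₁ = divides (ε * m) +k₁≡
        2∣k₂ : + 2 ∣ + k₂
        2∣k₂ = divides l +k₂≡
        divides-2 : ∀ {d} → d ℕ∣.∣ n → + d ∣ ε * m * + k₂ → d ℕ∣.∣ 2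
        divides-2 {d} d∣n d∣εmk₂ = ∣⇒∣ᵤ (subst (+ d ∣_) (begin
          (+ 2 - m * + k₂) + ε * (ε * m * + k₂)    ≡⟨ regroup (+ 2) m (+ k₂) ε ⟩
          (+ 2 - m * + k₂) + ε * ε * (m * + k₂)    ≡⟨ cong (λ z → + 2 - m * + k₂ + z * (m * + k₂)) ε²≡1 ⟩
          (+ 2 - m * + k₂) + 1ℤ * (m * + k₂)       ≡⟨ collapse (+ 2) (m * + k₂) ⟩
          + 2                                      ∎)
          (∣m∣n⇒∣m+n (∣-trans (∣ᵤ⇒∣ d∣n) n∣2-mk₂) (∣n⇒∣m*n ε d∣εmk₂)))
          where
          regroup : ∀ x y z e → (x - y * z) + e * (e * y * z) ≡ (x - y * z) + e * e * (y * z)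
          regroup = solve-∀
          collapse : ∀ x y → (x - y) + 1ℤ * y ≡ x
          collapse = solve-∀
        half≡ : + (k₁ ℕ.* k₂ ℕ./ 2) ≡ ε * m * + k₂
        half≡ with ∣⇒∣ᵤ 2∣k₁
        ... | ℕ∣.divides j k₁≡j*2 = begin
          + (k₁ ℕ.* k₂ ℕ./ 2)          ≡⟨ cong (λ k → + (k ℕ.* k₂ ℕ./ 2)) k₁≡j*2 ⟩
          + (j ℕ.* 2 ℕ.* k₂ ℕ./ 2)     ≡⟨ cong +_ (half-* j k₂) ⟩
          + (j ℕ.* k₂)                 ≡⟨ pos-* j k₂ ⟩
          + j * + k₂                   ≡⟨ cong (_* + k₂) (*-cancelʳ-≡ (+ j) (ε * m) (+ 2)
                                            (trans (sym (pos-* j 2)) (trans (cong +_ (sym k₁≡j*2)) +k₁≡))) ⟩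
          ε * m * + k₂                 ∎

    -- The symmetry supplies the turn for the inverse map.
    Arithmetic-sym : ∀ {ε k₁ k₂} → Arithmetic ε k₁ k₂ → Arithmetic ε k₂ k₁
    Arithmetic-sym {ε} {k₁} {k₂} (arithmetic gcd₁ gcd₂ n∣half) =
      arithmetic gcd₂ gcd₁ (subst (λ z → + n ∣ + (z ℕ./ 2) - ε * + 2) (ℕₚ.*-comm k₁ k₂) n∣half)

    -- The isomorphism induced by a reflection or quarter turn.

    unit : Sign → ℤ
    unit Sign.+ = 1ℤ
    unit Sign.- = -1ℤ

    unit² : ∀ s → unit s * unit s ≡ 1ℤ
    unit² Sign.+ = refl
    unit² Sign.- = refl

    -- The sign + gives the reflection in the diagonal, the sign - the rotation by 90 degrees.
    rotate unrotate : Sign → ℤ² → ℤ²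
    rotate   s (i , j) = unit s * j , i
    unrotate s (p , q) = q , unit s * p

    unit-involutive : ∀ s i → unit s * (unit s * i) ≡ i
    unit-involutive s i =
      trans (sym (*-assoc (unit s) (unit s) i)) (trans (cong (_* i) (unit² s)) (*-identityˡ i))

    rotate-unrotate : ∀ s v → rotate s (unrotate s v) ≡ v
    rotate-unrotate s (p , q) = cong (_, q) (unit-involutive s p)

    unrotate-rotate : ∀ s v → unrotate s (rotate s v) ≡ v
    unrotate-rotate s (i , j) = cong (i ,_) (unit-involutive s j)

    *-distribˡ-minus : ∀ x y z → x * y - x * z ≡ x * (y - z)
    *-distribˡ-minus = solve-∀

    rotate-⊕ : ∀ s x y → rotate s x ⊕ rotate s y ≡ rotate s (x ⊕ y)
    rotate-⊕ s (i , j) (i′ , j′) = cong (_, i + i′) (sym (*-distribˡ-+ (unit s) j j′))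

    rotate-⊖ : ∀ s x y → rotate s x ⊖ rotate s y ≡ rotate s (x ⊖ y)
    rotate-⊖ s (i , j) (i′ , j′) = cong (_, i - i′) (*-distribˡ-minus (unit s) j j′)

    -- The reflection is its own inverse; the rotation squares to -1, so its inverse is itself
    -- followed by `opp`.
    spin unspin : Sign → Dir → Dir
    spin Sign.+ a⁺ = b⁺
    spin Sign.+ a⁻ = b⁻
    spin Sign.+ b⁺ = a⁺
    spin Sign.+ b⁻ = a⁻
    spin Sign.- a⁺ = b⁺
    spin Sign.- a⁻ = b⁻
    spin Sign.- b⁺ = a⁻
    spin Sign.- b⁻ = a⁺
    unspin Sign.+ d = spin Sign.+ d
    unspin Sign.- d = opp (spin Sign.- d)

    rotate-⟦⟧ : ∀ s d → rotate s ⟦ d ⟧ ≡ ⟦ spin s d ⟧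
    rotate-⟦⟧ Sign.+ a⁺ = refl
    rotate-⟦⟧ Sign.+ a⁻ = refl
    rotate-⟦⟧ Sign.+ b⁺ = refl
    rotate-⟦⟧ Sign.+ b⁻ = refl
    rotate-⟦⟧ Sign.- a⁺ = refl
    rotate-⟦⟧ Sign.- a⁻ = refl
    rotate-⟦⟧ Sign.- b⁺ = refl
    rotate-⟦⟧ Sign.- b⁻ = refl

    spin-unspin : ∀ s d → spin s (unspin s d) ≡ d
    spin-unspin Sign.+ a⁺ = refl
    spin-unspin Sign.+ a⁻ = refl
    spin-unspin Sign.+ b⁺ = refl
    spin-unspin Sign.+ b⁻ = refl
    spin-unspin Sign.- a⁺ = refl
    spin-unspin Sign.- a⁻ = refl
    spin-unspin Sign.- b⁺ = refl
    spin-unspin Sign.- b⁻ = refl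

    Λ-* : ∀ {k p q} i → Λ k (p , q) → Λ k (i * p , i * q)
    Λ-* {k} {p} i (lattice m e r) = lattice (i * m)
      (trans (cong (i *_) e) (sym (*-assoc i m (+ 2))))
      (subst (+ n ∣_) (identity i p m (+ k)) (∣n⇒∣m*n i r))
      where
      identity : ∀ i p m k → i * (p - m * k) ≡ i * p - i * m * k
      identity = solve-∀

    module _ {s : Sign} {k₁ k₂ : ℕ} where

      -- A vector m (k₁ , 2) + t (n , 0) is sent to ε m (2 , ε k₁) + t (0 , n), where ε is the unit
      -- of s.
      rotate-Λ : ∀ {v} → Turn (unit s) k₁ k₂ → Λ k₁ v → Λ k₂ (rotate s v)
      rotate-Λ {p , q} (turn closes rotates) (lattice m q≡m*2 (divides t p-mk≡tn)) =
        subst (Λ k₂) (cong₂ _,_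
          (trans (first (unit s) m (+ 2) t) (cong (unit s *_) (sym q≡m*2)))
          (trans (cong₂ _+_ (second (unit s) m (+ k₁)) (sym p-mk≡tn))
            (trans (cong (λ z → z * (m * + k₁) + (p - m * + k₁)) (unit² s)) (collapse (m * + k₁) p))))
          (Λ-⊕ (Λ-* (unit s * m) rotates) (Λ-* t closes))
        where
        first : ∀ e m x t → e * m * x + t * 0ℤ ≡ e * (m * x)
        first = solve-∀
        second : ∀ e m k → e * m * (e * k) ≡ e * e * (m * k)
        second = solve-∀
        collapse : ∀ x p → 1ℤ * x + (p - x) ≡ p
        collapse = solve-∀

      -- A vector m (k₂ , 2) + t (n , 0) is sent to m (2 , ε k₂) + ε t (0 , n).
      unrotate-Λ : ∀ {v} → Turn (unit s) k₂ k₁ → Λ k₂ v → Λ k₁ (unrotate s v)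
      unrotate-Λ {p , q} (turn closes rotates) (lattice m q≡m*2 (divides t p-mk≡tn)) =
        subst (Λ k₁) (cong₂ _,_
          (trans (first m (+ 2) (unit s * t)) (sym q≡m*2))
          (trans (factor (unit s) m (+ k₂) t (+ n))
            (trans (cong (λ z → unit s * (m * + k₂ + z)) (sym p-mk≡tn))
              (cong (unit s *_) (collapse (m * + k₂) p)))))
          (Λ-⊕ (Λ-* m rotates) (Λ-* (unit s * t) closes))
        where
        first : ∀ m x t → m * x + t * 0ℤ ≡ m * x
        first = solve-∀
        factor : ∀ e m k t z → m * (e * k) + e * t * z ≡ e * (m * k + t * z)
        factor = solve-∀
        collapse : ∀ x p → x + (p - x) ≡ p
        collapse = solve-∀

    turns⇒lift : ∀ {k₁ k₂} s → Turn (unit s) k₁ k₂ → Turn (unit s) k₂ k₁ → Lift k₁ k₂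
    turns⇒lift {k₁} {k₂} s turn₁₂ turn₂₁ = record
      { to        = rotate s
      ; from      = unrotate s
      ; to-cong   = rotate-cong
      ; injective = rotate-injective
      ; to-from   = λ y → ≈-reflexive (rotate-unrotate s y)
      ; adj-to    = λ { {x} {y} (edge d l) → edge (spin s d)
                      (subst (rotate s y ≈[ k₂ ]_) (rotate-step x d) (rotate-cong l)) }
      ; adj-from  = λ { {x} {y} (edge d l) → edge (unspin s d)
                      (rotate-injective (subst (rotate s y ≈[ k₂ ]_)
                        (sym (trans (rotate-step x (unspin s d)) (cong (λ e → rotate s x ⊕ ⟦ e ⟧) (spin-unspin s d))))
                        l)) }
      }
      where
      rotate-cong : ∀ {x y} → x ≈[ k₁ ] y → rotate s x ≈[ k₂ ] rotate s y
      rotate-cong {x} {y} (modΛ l) = Λ⇒≈ (rotate-Λ {s} turn₁₂ l) (sym (rotate-⊖ s x y))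
      rotate-injective : ∀ {x y} → rotate s x ≈[ k₂ ] rotate s y → x ≈[ k₁ ] y
      rotate-injective {x} {y} (modΛ l) = Λ⇒≈ (unrotate-Λ {s} turn₂₁ l)
        (trans (cong (unrotate s) (rotate-⊖ s x y)) (unrotate-rotate s (x ⊖ y)))
      rotate-step : ∀ x d → rotate s (x ⊕ ⟦ d ⟧) ≡ rotate s x ⊕ ⟦ spin s d ⟧
      rotate-step x d = trans (sym (rotate-⊕ s x ⟦ d ⟧)) (cong (rotate s x ⊕_) (rotate-⟦⟧ s d))

    -- Short lattice vectors and common neighbours.

    -- Split on the size of the coefficient m of (k , 2), where the height is 2 m. For 0, n divides
    -- the small p. For 1, the bound on p is below k, yet n dividing p - m k forces it to be k. For
    -- 2, p = 0 and n divides 2 k < n, so k = 0, against 4 ≤ k + 1. From 3 on the height exceeds 4.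
    -- Strictness is tied to height 4 so that 2 k = n can be treated too.
    short⇒𝟎 : ∀ {k r v} → r ℕ.≤ suc k → r ℕ.< n → r ℕ.≤ 4 → 2 ℕ.* k ℕ.≤ n →
              (∣ proj₂ v ∣ ≡ 4 → 2 ℕ.* k ℕ.< n) →
              Λ k v → ‖ v ‖ ℕ.≤ r → v ≡ 𝟎
    short⇒𝟎 {k} {r} {p , q} r≤1+k r<n r≤4 2k≤n 2k<n (lattice m q≡m*2 n∣rest) ‖v‖≤r = case (∣ m ∣) refl
      where
      ∣mk∣ : ∀ {a} → ∣ m ∣ ≡ a → ∣ m * + k ∣ ≡ a ℕ.* k
      ∣mk∣ refl = abs-* m (+ k)
      ∣q∣ : ∀ {a} → ∣ m ∣ ≡ a → ∣ q ∣ ≡ a ℕ.* 2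
      ∣q∣ refl = trans (cong ∣_∣ q≡m*2) (abs-* m (+ 2))
      ∣p∣+∣q∣≤r : ∀ {a} → ∣ m ∣ ≡ a → ∣ p ∣ ℕ.+ a ℕ.* 2 ℕ.≤ r
      ∣p∣+∣q∣≤r ∣m∣≡a = subst (λ z → ∣ p ∣ ℕ.+ z ℕ.≤ r) (∣q∣ ∣m∣≡a) ‖v‖≤r
      p≡mk : ∣ p - m * + k ∣ ℕ.< n → p ≡ m * + k
      p≡mk rest<n = i-j≡0⇒i≡j p (m * + k) (∣-small⇒≡0 n∣rest rest<n)
      case : ∀ a → ∣ m ∣ ≡ a → (p , q) ≡ 𝟎
      case 0 ∣m∣≡0 = cong₂ _,_
        (∣-small⇒≡0 n∣p (ℕₚ.≤-<-trans (ℕₚ.m+n≤o⇒m≤o (∣ p ∣) ‖v‖≤r) r<n))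
        (∣i∣≡0⇒i≡0 (∣q∣ ∣m∣≡0))
        where
        n∣p : + n ∣ p
        n∣p = subst (+ n ∣_) (+-identityʳ p)
          (subst (λ z → + n ∣ p - z * + k) (∣i∣≡0⇒i≡0 {m} ∣m∣≡0) n∣rest)
      case 1 ∣m∣≡1 = ⊥-elim (ℕₚ.<-irrefl ∣p∣≡k ∣p∣<k)
        where
        ∣mk∣≡k : ∣ m * + k ∣ ≡ k
        ∣mk∣≡k = trans (∣mk∣ ∣m∣≡1) (ℕₚ.*-identityˡ k)
        ∣p∣<k : ∣ p ∣ ℕ.< k
        ∣p∣<k = ℕₚ.≤-pred (subst (ℕ._≤ suc k) (ℕₚ.+-comm (∣ p ∣) 2)
          (ℕₚ.≤-trans (∣p∣+∣q∣≤r ∣m∣≡1) r≤1+k))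
        rest<n : ∣ p - m * + k ∣ ℕ.< n
        rest<n = begin-strict
          ∣ p - m * + k ∣        ≤⟨ ∣i-j∣≤∣i∣+∣j∣ p (m * + k) ⟩
          ∣ p ∣ ℕ.+ ∣ m * + k ∣  ≡⟨ cong (∣ p ∣ ℕ.+_) ∣mk∣≡k ⟩
          ∣ p ∣ ℕ.+ k            <⟨ ℕₚ.+-monoˡ-< k ∣p∣<k ⟩
          k ℕ.+ k                ≡⟨ cong (k ℕ.+_) (ℕₚ.+-identityʳ k) ⟨
          2 ℕ.* k                ≤⟨ 2k≤n ⟩
          n                      ∎
          where open ℕₚ.≤-Reasoning
        ∣p∣≡k : ∣ p ∣ ≡ k
        ∣p∣≡k = trans (cong ∣_∣ (p≡mk rest<n)) ∣mk∣≡k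
      case 2 ∣m∣≡2 = ⊥-elim (ℕₚ.<⇒≱ (s≤s z≤n) (subst (3 ℕ.≤_) k≡0 3≤k))
        where
        4≤r : 4 ℕ.≤ r
        4≤r = ℕₚ.m+n≤o⇒n≤o (∣ p ∣) (∣p∣+∣q∣≤r ∣m∣≡2)
        3≤k : 3 ℕ.≤ k
        3≤k = ℕₚ.≤-pred (ℕₚ.≤-trans 4≤r r≤1+k)
        p≡0 : p ≡ 0ℤ
        p≡0 = ∣i∣≡0⇒i≡0 (ℕₚ.n≤0⇒n≡0 (ℕₚ.+-cancelʳ-≤ 4 _ 0 (ℕₚ.≤-trans (∣p∣+∣q∣≤r ∣m∣≡2) r≤4)))
        ∣rest∣≡2k : ∣ p - m * + k ∣ ≡ 2 ℕ.* k
        ∣rest∣≡2k = trans (cong (λ z → ∣ z - m * + k ∣) p≡0)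
          (trans (cong ∣_∣ (+-identityˡ (- (m * + k)))) (trans (∣-i∣≡∣i∣ (m * + k)) (∣mk∣ ∣m∣≡2)))
        k≡0 : k ≡ 0
        k≡0 = ℕₚ.m+n≡0⇒m≡0 k (trans (sym ∣rest∣≡2k)
          (cong ∣_∣ (∣-small⇒≡0 n∣rest (subst (ℕ._< n) (sym ∣rest∣≡2k) (2k<n (∣q∣ ∣m∣≡2))))))
      case (suc (suc (suc i))) ∣m∣≡3+i = ⊥-elim (ℕₚ.<⇒≱ (s≤s (s≤s (s≤s (s≤s (s≤s z≤n)))))
        (ℕₚ.m+n≤o⇒n≤o (∣ p ∣) (ℕₚ.≤-trans (∣p∣+∣q∣≤r ∣m∣≡3+i) r≤4)))

    -- Paths of length two starting with e and f meet modulo Λ only where they meet in ℤ². The pair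
    -- is a parameter because at 2 k = n the vector (0 , 4) lies in Λ, which breaks this for `b⁺`,
    -- `b⁻` but leaves `a⁺`, `a⁻` usable.
    RigidAt : ℕ → Dir → Dir → Set
    RigidAt k e f = ∀ s t → ⟦ e ⟧ ⊕ ⟦ s ⟧ ≈[ k ] ⟦ f ⟧ ⊕ ⟦ t ⟧ → ⟦ e ⟧ ⊕ ⟦ s ⟧ ≡ ⟦ f ⟧ ⊕ ⟦ t ⟧

    Rigid : ℕ → Set
    Rigid k = ∀ e f → RigidAt k e f

    rigidAt : ∀ {k} e f → 3 ℕ.≤ k → 2 ℕ.* k ℕ.≤ n →
              (∀ s t → ∣ proj₂ ((⟦ e ⟧ ⊕ ⟦ s ⟧) ⊖ (⟦ f ⟧ ⊕ ⟦ t ⟧)) ∣ ≡ 4 → 2 ℕ.* k ℕ.< n) →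
              RigidAt k e f
    rigidAt e f 3≤k 2k≤n 2k<n s t (modΛ l) = ⊖≡𝟎⇒≡ (short⇒𝟎 (s≤s 3≤k)
      (ℕₚ.≤-trans (s≤s (s≤s (s≤s (s≤s (s≤s z≤n))))) (ℕₚ.≤-trans (ℕₚ.*-monoʳ-≤ 2 3≤k) 2k≤n))
      ℕₚ.≤-refl 2k≤n (2k<n s t) l
      (ℕₚ.≤-trans (‖⊖‖ (⟦ e ⟧ ⊕ ⟦ s ⟧) (⟦ f ⟧ ⊕ ⟦ t ⟧)) (ℕₚ.+-mono-≤ (‖⟦⟧⊕⟦⟧‖ e s) (‖⟦⟧⊕⟦⟧‖ f t))))

    ⊕-cancelˡ : ∀ {k} x {u v} → x ⊕ u ≈[ k ] x ⊕ v → u ≈[ k ] v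
    ⊕-cancelˡ (i , j) {p , q} {p′ , q′} (modΛ l) =
      Λ⇒≈ l (cong₂ _,_ (identity i p p′) (identity j q q′))
      where
      identity : ∀ x u v → (x + u) - (x + v) ≡ u - v
      identity = solve-∀

    ⊕-assoc : ∀ x y z → x ⊕ y ⊕ z ≡ x ⊕ (y ⊕ z)
    ⊕-assoc (i , j) (p , q) (p′ , q′) = cong₂ _,_ (+-assoc i p p′) (+-assoc j q q′)

    ⊕-comm : ∀ x y → x ⊕ y ≡ y ⊕ x
    ⊕-comm (i , j) (p , q) = cong₂ _,_ (+-comm i p) (+-comm j q)

    ⊕-identityʳ : ∀ x → x ⊕ 𝟎 ≡ x
    ⊕-identityʳ (i , j) = cong₂ _,_ (+-identityʳ i) (+-identityʳ j)

    ⊕-⊖ : ∀ x y → x ⊕ y ⊖ x ≡ y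
    ⊕-⊖ (i , j) (p , q) = cong₂ _,_ (identity i p) (identity j q)
      where
      identity : ∀ x y → x + y - x ≡ y
      identity = solve-∀

    ⊖-⊕ : ∀ x y → x ⊕ (y ⊖ x) ≡ y
    ⊖-⊕ (i , j) (p , q) = cong₂ _,_ (identity i p) (identity j q)
      where
      identity : ∀ x y → x + (y - x) ≡ y
      identity = solve-∀

    ⊕-swapʳ : ∀ x y z → x ⊕ y ⊕ z ≡ x ⊕ z ⊕ y
    ⊕-swapʳ x y z = trans (⊕-assoc x y z) (trans (cong (x ⊕_) (⊕-comm y z)) (sym (⊕-assoc x z y)))

    -- Rigidity moves the meeting of the two paths into ℤ², where `unit-rhombus` decides.
    common-neighbour : ∀ {k e f x w} → RigidAt k e f → ⟦ e ⟧ ≢ ⟦ f ⟧ →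
                       Adjacent k (x ⊕ ⟦ e ⟧) w → Adjacent k (x ⊕ ⟦ f ⟧) w →
                       w ≈[ k ] x ⊎ w ≈[ k ] x ⊕ (⟦ e ⟧ ⊕ ⟦ f ⟧)
    common-neighbour {k} {e} {f} {x} {w} rigid e≢f (edge s l) (edge t l′) =
      [ (λ es≡𝟎 → inj₁ (subst (w ≈[ k ]_) (trans (cong (x ⊕_) es≡𝟎) (⊕-identityʳ x)) w≈xes))
      , (λ es≡ef → inj₂ (subst (λ v → w ≈[ k ] x ⊕ v) es≡ef w≈xes)) ]′
      (unit-rhombus e f s t (rigid s t (⊕-cancelˡ x (≈-trans (≈-sym w≈xes) w≈xft))) e≢f)
      where
      w≈xes : w ≈[ k ] x ⊕ (⟦ e ⟧ ⊕ ⟦ s ⟧)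
      w≈xes = subst (w ≈[ k ]_) (⊕-assoc x ⟦ e ⟧ ⟦ s ⟧) l
      w≈xft : w ≈[ k ] x ⊕ (⟦ f ⟧ ⊕ ⟦ t ⟧)
      w≈xft = subst (w ≈[ k ]_) (⊕-assoc x ⟦ f ⟧ ⟦ t ⟧) l′

    -- Squares go to squares, so isomorphisms are affine.

    module _ {k₁ k₂ : ℕ} (φ : Lift k₁ k₂) where
      open Lift φ

      -- The preimage of the corner to x + c + d is a common neighbour of x + e and x + f.
      to-square : ∀ {e f x c d} → RigidAt k₁ e f → ⟦ e ⟧ ≢ ⟦ f ⟧ →
                  to (x ⊕ ⟦ e ⟧) ≈[ k₂ ] to x ⊕ ⟦ c ⟧ → to (x ⊕ ⟦ f ⟧) ≈[ k₂ ] to x ⊕ ⟦ d ⟧ →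
                  to x ⊕ (⟦ c ⟧ ⊕ ⟦ d ⟧) ≈[ k₂ ] to x ⊎
                  to x ⊕ (⟦ c ⟧ ⊕ ⟦ d ⟧) ≈[ k₂ ] to (x ⊕ (⟦ e ⟧ ⊕ ⟦ f ⟧))
      to-square {e} {f} {x} {c} {d} rigid e≢f c-edge d-edge =
        [ inj₁ ∘ back , inj₂ ∘ back ]′ (common-neighbour rigid e≢f
          (adj-from (edge d (≈-trans (to-from w) (⊕-cong
            (≈-sym c-edge) (≈-refl ⟦ d ⟧) ∘≈ sym (⊕-assoc (to x) ⟦ c ⟧ ⟦ d ⟧)))))
          (adj-from (edge c (≈-trans (to-from w) (⊕-cong
            (≈-sym d-edge) (≈-refl ⟦ c ⟧) ∘≈ trans (sym (⊕-assoc (to x) ⟦ c ⟧ ⟦ d ⟧)) (⊕-swapʳ (to x) ⟦ c ⟧ ⟦ d ⟧))))))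
        where
        w = to x ⊕ (⟦ c ⟧ ⊕ ⟦ d ⟧)
        back : ∀ {y} → from w ≈[ k₁ ] y → w ≈[ k₂ ] to y
        back l = ≈-trans (≈-sym (to-from w)) (to-cong l)
        _∘≈_ : ∀ {y y′ z} → y ≈[ k₂ ] z → y′ ≡ y → y′ ≈[ k₂ ] z
        l ∘≈ refl = l

      module _ (rigid : Rigid k₁) where

        unit-injective : ∀ {e f} → ⟦ e ⟧ ≈[ k₁ ] ⟦ f ⟧ → ⟦ e ⟧ ≡ ⟦ f ⟧
        -- Adding `a⁺` to both sides produces paths of length two, to which rigidity applies.
        unit-injective {e} {f} l = cancel (rigid e f a⁺ a⁺ (⊕-cong l (≈-refl ⟦ a⁺ ⟧)))
          where
          cancel : ∀ {u v} → u ⊕ ⟦ a⁺ ⟧ ≡ v ⊕ ⟦ a⁺ ⟧ → u ≡ v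
          cancel {u} {v} eq = trans (sym (⊕-⊖ ⟦ a⁺ ⟧ u)) (trans
            (cong (_⊖ ⟦ a⁺ ⟧) (trans (⊕-comm ⟦ a⁺ ⟧ u) (trans eq (⊕-comm v ⟦ a⁺ ⟧)))) (⊕-⊖ ⟦ a⁺ ⟧ v))

        -- A priori the direction varies with x; `Δ-invariant` makes it constant modulo Λ.
        image : Dir → ℤ² → Dir
        image d x = Adjacent.direction (adj-to {x} (edge d (≈-refl (x ⊕ ⟦ d ⟧))))

        to-edge : ∀ d x → to (x ⊕ ⟦ d ⟧) ≈[ k₂ ] to x ⊕ ⟦ image d x ⟧
        to-edge d x = Adjacent.along (adj-to {x} (edge d (≈-refl (x ⊕ ⟦ d ⟧))))

        -- Both outcomes of `to-square` agree here, since f and `opp f` cancel.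
        to-opp : ∀ {f x d d′} → to (x ⊕ ⟦ f ⟧) ≈[ k₂ ] to x ⊕ ⟦ d ⟧ →
                 to (x ⊕ ⟦ opp f ⟧) ≈[ k₂ ] to x ⊕ ⟦ d′ ⟧ →
                 to x ⊕ (⟦ d ⟧ ⊕ ⟦ d′ ⟧) ≈[ k₂ ] to x
        to-opp {f} {x} {d} {d′} d-edge d′-edge =
          [ (λ l → l)
          , subst (λ v → to x ⊕ (⟦ d ⟧ ⊕ ⟦ d′ ⟧) ≈[ k₂ ] to v)
              (trans (cong (x ⊕_) (⟦opp⟧ f)) (⊕-identityʳ x)) ]′
          (to-square {f} {opp f} {x} {d} {d′} (rigid f (opp f)) (⟦opp⟧-≢ f) d-edge d′-edge)

        -- The image of a square is a square: its corner x ⊕ c ⊕ d cannot fall back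
        -- on x, as c and the image of opp f would then be the same edge at x.
        parallelogram : ∀ {e f x c d} → ⟦ e ⟧ ≢ ⟦ f ⟧ →
                        to (x ⊕ ⟦ e ⟧) ≈[ k₂ ] to x ⊕ ⟦ c ⟧ → to (x ⊕ ⟦ f ⟧) ≈[ k₂ ] to x ⊕ ⟦ d ⟧ →
                        to x ⊕ (⟦ c ⟧ ⊕ ⟦ d ⟧) ≈[ k₂ ] to (x ⊕ (⟦ e ⟧ ⊕ ⟦ f ⟧))
        parallelogram {e} {f} {x} {c} {d} e≢f c-edge d-edge =
          [ fold , (λ l → l) ]′ (to-square {e} {f} {x} {c} {d} (rigid e f) e≢f c-edge d-edge)
          where
          d′ = image (opp f) x
          fold : to x ⊕ (⟦ c ⟧ ⊕ ⟦ d ⟧) ≈[ k₂ ] to x →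
                 to x ⊕ (⟦ c ⟧ ⊕ ⟦ d ⟧) ≈[ k₂ ] to (x ⊕ (⟦ e ⟧ ⊕ ⟦ f ⟧))
          -- Falling back on x forces e = `opp f`, and then the fourth corner x + e + f is x itself.
          fold l = subst (λ v → to x ⊕ (⟦ c ⟧ ⊕ ⟦ d ⟧) ≈[ k₂ ] to v) (sym x⊕ef≡x) l
            where
            c≈d′ : ⟦ c ⟧ ≈[ k₂ ] ⟦ d′ ⟧
            c≈d′ = ⊕-cancelˡ ⟦ d ⟧ (⊕-cancelˡ (to x) (≈-trans
              (subst (λ v → to x ⊕ v ≈[ k₂ ] to x) (⊕-comm ⟦ c ⟧ ⟦ d ⟧) l)
              (≈-sym (to-opp {f} {x} {d} {d′} d-edge (to-edge (opp f) x)))))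
            e≡oppf : ⟦ e ⟧ ≡ ⟦ opp f ⟧
            e≡oppf = unit-injective {e} {opp f} (⊕-cancelˡ x (injective (≈-trans c-edge (≈-trans
              (⊕-cong (≈-refl (to x)) c≈d′) (≈-sym (to-edge (opp f) x))))))
            x⊕ef≡x : x ⊕ (⟦ e ⟧ ⊕ ⟦ f ⟧) ≡ x
            x⊕ef≡x = trans (cong (x ⊕_) (trans (cong (_⊕ ⟦ f ⟧) e≡oppf)
              (trans (⊕-comm ⟦ opp f ⟧ ⟦ f ⟧) (⟦opp⟧ f)))) (⊕-identityʳ x)

        -- The discrete derivative of `to`; its constancy is affineness.
        Δ : Dir → ℤ² → ℤ²
        Δ e x = to (x ⊕ ⟦ e ⟧) ⊖ to x

        Δ≈ : ∀ e x → Δ e x ≈[ k₂ ] ⟦ image e x ⟧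
        Δ≈ e x = subst (Δ e x ≈[ k₂ ]_) (⊕-⊖ (to x) ⟦ image e x ⟧) (⊖-cong (to-edge e x) (≈-refl (to x)))

        -- In the image parallelogram, to x + c + d minus to x + d leaves c.
        Δ-shift : ∀ {e f} → ⟦ e ⟧ ≢ ⟦ f ⟧ → ∀ x → Δ e (x ⊕ ⟦ f ⟧) ≈[ k₂ ] Δ e x
        Δ-shift {e} {f} e≢f x = ≈-trans
          (⊖-cong (subst (λ v → to v ≈[ k₂ ] to x ⊕ (c ⊕ d)) ef≡fe
            (≈-sym (parallelogram {e} {f} {x} {image e x} {image f x} e≢f (to-edge e x) (to-edge f x)))) (to-edge f x))
          (subst (_≈[ k₂ ] Δ e x) (sym (shorten (to x) c d)) (≈-sym (Δ≈ e x)))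
          where
          c d : ℤ²
          c = ⟦ image e x ⟧
          d = ⟦ image f x ⟧
          ef≡fe : x ⊕ (⟦ e ⟧ ⊕ ⟦ f ⟧) ≡ x ⊕ ⟦ f ⟧ ⊕ ⟦ e ⟧
          ef≡fe = trans (sym (⊕-assoc x ⟦ e ⟧ ⟦ f ⟧)) (⊕-swapʳ x ⟦ e ⟧ ⟦ f ⟧)
          shorten : ∀ x c d → x ⊕ (c ⊕ d) ⊖ (x ⊕ d) ≡ c
          shorten (i , j) (p , q) (p′ , q′) = cong₂ _,_ (identity i p p′) (identity j q q′)
            where
            identity : ∀ x c d → x + (c + d) - (x + d) ≡ c
            identity = solve-∀

        Δ-invariant : ∀ e f x → Δ e (x ⊕ ⟦ f ⟧) ≈[ k₂ ] Δ e x
        Δ-invariant e f x with ⟦ e ⟧ ≟² ⟦ f ⟧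
        ... | no e≢f  = Δ-shift {e} {f} e≢f x
        -- Along e itself, shift from x + e back to x by `opp e`, which differs from e.
        ... | yes e≡f = subst (λ v → Δ e (x ⊕ v) ≈[ k₂ ] Δ e x) e≡f (≈-sym
          (subst (λ v → Δ e v ≈[ k₂ ] Δ e (x ⊕ ⟦ e ⟧))
            (trans (⊕-assoc x ⟦ e ⟧ ⟦ opp e ⟧) (trans (cong (x ⊕_) (⟦opp⟧ e)) (⊕-identityʳ x)))
            (Δ-shift {e} {opp e} (⟦opp⟧-≢ e) (x ⊕ ⟦ e ⟧))))

    -- Multiples of vectors and signs of units.

    ·-suc : ∀ i v → suc i · v ≡ i · v ⊕ v
    ·-suc i (p , q) = cong₂ _,_ (identity (+ i) p) (identity (+ i) q)
      where
      identity : ∀ i x → (1ℤ + i) * x ≡ i * x + x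
      identity = solve-∀

    ·-cong : ∀ {k u v} i → u ≈[ k ] v → i · u ≈[ k ] i · v
    ·-cong {k} {p , q} {p′ , q′} i (modΛ l) = Λ⇒≈ (Λ-* (+ i) l)
      (cong₂ _,_ (sym (*-distribˡ-minus (+ i) p p′)) (sym (*-distribˡ-minus (+ i) q q′)))

    ⊕-·-suc : ∀ x i v → x ⊕ suc i · v ≡ x ⊕ i · v ⊕ v
    ⊕-·-suc x i v = trans (cong (x ⊕_) (·-suc i v)) (sym (⊕-assoc x (i · v) v))

    ≈𝟎⇒Λ : ∀ {k u} → u ≈[ k ] 𝟎 → Λ k u
    ≈𝟎⇒Λ {k} {p , q} (modΛ l) = subst (Λ k) (cong₂ _,_ (+-identityʳ p) (+-identityʳ q)) l

    ≈⊕⇒≈𝟎 : ∀ {k x u} → x ≈[ k ] x ⊕ u → u ≈[ k ] 𝟎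
    ≈⊕⇒≈𝟎 {k} {x} {u} l = ≈-sym (⊕-cancelˡ x (subst (_≈[ k ] x ⊕ u) (sym (⊕-identityʳ x)) l))

    ∣unit∣ : ∀ s → ∣ unit s ∣ ≡ 1
    ∣unit∣ Sign.+ = refl
    ∣unit∣ Sign.- = refl

    unit-* : ∀ s t → unit s * unit t ≡ unit (s Sgn.* t)
    unit-* Sign.+ Sign.+ = refl
    unit-* Sign.+ Sign.- = refl
    unit-* Sign.- Sign.+ = refl
    unit-* Sign.- Sign.- = refl

    axis : ∀ d → (∃ λ s → ⟦ d ⟧ ≡ (unit s , 0ℤ)) ⊎ (∃ λ s → ⟦ d ⟧ ≡ (0ℤ , unit s))
    axis a⁺ = inj₁ (Sign.+ , refl)
    axis a⁻ = inj₁ (Sign.- , refl)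
    axis b⁺ = inj₂ (Sign.+ , refl)
    axis b⁻ = inj₂ (Sign.- , refl)

    units-parallel : ∀ s t → unit s ≡ unit t ⊎ unit s + unit t ≡ 0ℤ
    units-parallel Sign.+ Sign.+ = inj₁ refl
    units-parallel Sign.+ Sign.- = inj₂ refl
    units-parallel Sign.- Sign.+ = inj₂ refl
    units-parallel Sign.- Sign.- = inj₁ refl

    -- Excludes maps that keep the axes: ± k₁ and ± k₂ differ by less than 2 k₂ ≤ n, so a congruence
    -- between them is an equality.
    Λ-unstraight : ∀ {k₁ k₂} s t → k₁ ℕ.< k₂ → 2 ℕ.* k₂ ℕ.≤ n →
                   ¬ Λ k₂ (+ k₁ * unit s , unit t * + 2)
    Λ-unstraight {k₁} {k₂} s t k₁<k₂ 2k₂≤n l = ℕₚ.<-irrefl k₁≡k₂ k₁<k₂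
      where
      ∣k₁s∣ : ∣ + k₁ * unit s ∣ ≡ k₁
      ∣k₁s∣ = trans (abs-* (+ k₁) (unit s)) (trans (cong (k₁ ℕ.*_) (∣unit∣ s)) (ℕₚ.*-identityʳ k₁))
      ∣tk₂∣ : ∣ unit t * + k₂ ∣ ≡ k₂
      ∣tk₂∣ = trans (abs-* (unit t) (+ k₂)) (trans (cong (ℕ._* k₂) (∣unit∣ t)) (ℕₚ.*-identityˡ k₂))
      small : ∣ + k₁ * unit s - unit t * + k₂ ∣ ℕ.< n
      small = begin-strict
        ∣ + k₁ * unit s - unit t * + k₂ ∣          ≤⟨ ∣i-j∣≤∣i∣+∣j∣ (+ k₁ * unit s) (unit t * + k₂) ⟩
        ∣ + k₁ * unit s ∣ ℕ.+ ∣ unit t * + k₂ ∣    ≡⟨ cong₂ ℕ._+_ ∣k₁s∣ ∣tk₂∣ ⟩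
        k₁ ℕ.+ k₂                                  <⟨ ℕₚ.+-monoˡ-< k₂ k₁<k₂ ⟩
        k₂ ℕ.+ k₂                                  ≡⟨ cong (k₂ ℕ.+_) (ℕₚ.+-identityʳ k₂) ⟨
        2 ℕ.* k₂                                   ≤⟨ 2k₂≤n ⟩
        n                                          ∎
        where open ℕₚ.≤-Reasoning
      k₁≡k₂ : k₁ ≡ k₂
      k₁≡k₂ = trans (sym ∣k₁s∣) (trans (cong ∣_∣ (i-j≡0⇒i≡j (+ k₁ * unit s) (unit t * + k₂)
        (∣-small⇒≡0 (Λ-at (unit t) l) small))) ∣tk₂∣)

    -- Images of the relations n a = 0 and k₁ a + 2 b = 0.

    module _ {k₁ k₂ : ℕ} (φ : Lift k₁ k₂) (rigid : Rigid k₁) where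
      open Lift φ

      private
        δ : Dir → ℤ² → ℤ²
        δ = Δ φ rigid
        im : Dir → ℤ²
        im e = ⟦ image φ rigid e 𝟎 ⟧

      Δ-line : ∀ e f i x → δ e (x ⊕ i · ⟦ f ⟧) ≈[ k₂ ] δ e x
      Δ-line e f zero    x = ≈-reflexive (cong (δ e) (⊕-identityʳ x))
      Δ-line e f (suc i) x = subst (λ v → δ e v ≈[ k₂ ] δ e x) (sym (⊕-·-suc x i ⟦ f ⟧))
        (≈-trans (Δ-invariant φ rigid e f (x ⊕ i · ⟦ f ⟧)) (Δ-line e f i x))

      to-line : ∀ e i x → to (x ⊕ i · ⟦ e ⟧) ≈[ k₂ ] to x ⊕ i · δ e x
      to-line e zero    x = ≈-reflexive (trans (cong to (⊕-identityʳ x)) (sym (⊕-identityʳ (to x))))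
      to-line e (suc i) x = subst₂ _≈[ k₂ ]_
        (trans (⊖-⊕ (to y) (to (y ⊕ ⟦ e ⟧))) (cong to (sym (⊕-·-suc x i ⟦ e ⟧))))
        (sym (⊕-·-suc (to x) i (δ e x)))
        (⊕-cong (to-line e i x) (Δ-line e e i x))
        where y = x ⊕ i · ⟦ e ⟧

      image-a-period : Λ k₂ (n · im a⁺)
      image-a-period = ≈𝟎⇒Λ (≈⊕⇒≈𝟎 (≈-trans
        (to-cong {𝟎} {𝟎 ⊕ n · ⟦ a⁺ ⟧} (Λ⇒≈ (lattice 0ℤ refl (divides -1ℤ (+-identityʳ (-1ℤ * + n))))
          (cong₂ _,_ (first (+ n)) (second (+ n)))))
        (≈-trans (to-line a⁺ n 𝟎) (⊕-cong (≈-refl (to 𝟎)) (·-cong n (Δ≈ φ rigid a⁺ 𝟎))))))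
        where
        first : ∀ x → -1ℤ * x ≡ 0ℤ - (0ℤ + x * 1ℤ)
        first = solve-∀
        second : ∀ x → 0ℤ ≡ 0ℤ - (0ℤ + x * 0ℤ)
        second = solve-∀

      -- The closed path of k₁ steps a and two steps b has a closed image; `Δ-line` carries the
      -- b-derivative at the corner y back to the origin.
      image-relation : Λ k₂ (k₁ · im a⁺ ⊕ 2 · im b⁺)
      image-relation = ≈𝟎⇒Λ (≈⊕⇒≈𝟎 (subst (to 𝟎 ≈[ k₂ ]_) (⊕-assoc (to 𝟎) (k₁ · im a⁺) (2 · im b⁺))
        (≈-trans (to-cong {𝟎} {y ⊕ 2 · ⟦ b⁺ ⟧} 𝟎≈y⊕2b)
        (≈-trans (to-line b⁺ 2 y)
        (⊕-cong (≈-trans (to-line a⁺ k₁ 𝟎) (⊕-cong (≈-refl (to 𝟎)) (·-cong k₁ (Δ≈ φ rigid a⁺ 𝟎))))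
                (·-cong 2 (≈-trans (Δ-line b⁺ a⁺ k₁ 𝟎) (Δ≈ φ rigid b⁺ 𝟎))))))))
        where
        y = 𝟎 ⊕ k₁ · ⟦ a⁺ ⟧
        first : ∀ k → -1ℤ * k ≡ 0ℤ - ((0ℤ + k * 1ℤ) + 0ℤ)
        first = solve-∀
        second : ∀ k → -1ℤ * + 2 ≡ 0ℤ - ((0ℤ + k * 0ℤ) + + 2)
        second = solve-∀
        zeroᵣ : ∀ k → 0ℤ * k ≡ -1ℤ * k - -1ℤ * k
        zeroᵣ = solve-∀
        𝟎≈y⊕2b : 𝟎 ≈[ k₁ ] y ⊕ 2 · ⟦ b⁺ ⟧
        𝟎≈y⊕2b = Λ⇒≈ {v = -1ℤ * + k₁ , -1ℤ * + 2} (lattice -1ℤ refl (divides 0ℤ (sym (zeroᵣ (+ k₁)))))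
          (cong₂ _,_ (first (+ k₁)) (second (+ k₁)))

      images-distinct : im a⁺ ≢ im b⁺
      images-distinct eq = a≢b (unit-injective φ rigid {a⁺} {b⁺}
        (⊕-cancelˡ 𝟎 (injective (≈-trans (to-edge φ rigid a⁺ 𝟎)
          (subst (λ v → to 𝟎 ⊕ v ≈[ k₂ ] to (𝟎 ⊕ ⟦ b⁺ ⟧)) (sym eq) (≈-sym (to-edge φ rigid b⁺ 𝟎)))))))
        where
        a≢b : ⟦ a⁺ ⟧ ≢ ⟦ b⁺ ⟧
        a≢b ()

      images-not-opposite : im a⁺ ⊕ im b⁺ ≢ 𝟎
      -- The origin is read as `a⁺` + `a⁻`, so that rigidity compares two paths of length two.
      images-not-opposite eq = a⊕b≢a⊕a⁻ (rigid a⁺ a⁺ b⁺ a⁻ (⊕-cancelˡ 𝟎 (injective (≈-sym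
        (subst (_≈[ k₂ ] to (𝟎 ⊕ (⟦ a⁺ ⟧ ⊕ ⟦ b⁺ ⟧))) (trans (cong (to 𝟎 ⊕_) eq) (⊕-identityʳ (to 𝟎)))
          (parallelogram φ rigid {a⁺} {b⁺} {𝟎} {image φ rigid a⁺ 𝟎} {image φ rigid b⁺ 𝟎}
            (λ ()) (to-edge φ rigid a⁺ 𝟎) (to-edge φ rigid b⁺ 𝟎)))))))
        where
        a⊕b≢a⊕a⁻ : ⟦ a⁺ ⟧ ⊕ ⟦ b⁺ ⟧ ≢ ⟦ a⁺ ⟧ ⊕ ⟦ a⁻ ⟧
        a⊕b≢a⊕a⁻ ()

      rigid⇒turn : k₁ ℕ.< k₂ → 2 ℕ.* k₂ ℕ.≤ n → ∃ λ s → Turn (unit s) k₁ k₂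
      rigid⇒turn k₁<k₂ 2k₂≤n with axis (image φ rigid a⁺ 𝟎) | axis (image φ rigid b⁺ 𝟎)
      ... | inj₁ (s , c≡) | inj₂ (t , d≡) = ⊥-elim (Λ-unstraight s t k₁<k₂ 2k₂≤n
        (subst (Λ k₂) (trans (cong₂ (λ c d → k₁ · c ⊕ 2 · d) c≡ d≡)
            (cong₂ _,_ (first (+ k₁) (unit s)) (second (+ k₁) (unit t))))
          image-relation))
        where
        first : ∀ k s → k * s + + 2 * 0ℤ ≡ k * s
        first = solve-∀
        second : ∀ k t → k * 0ℤ + + 2 * t ≡ t * + 2
        second = solve-∀
      -- The axes are swapped: the relations become (0 , n s) and (2 t , s k₁). Scaling by s and by
      -- t normalises them and leaves the sign t s.
      ... | inj₂ (s , c≡) | inj₁ (t , d≡) = t Sgn.* s , turn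
        (subst (Λ k₂) (cong₂ _,_ (*-zeroʳ (unit s))
            (trans (cong (unit s *_) (*-comm (+ n) (unit s))) (unit-involutive s (+ n))))
          (Λ-* (unit s) (subst (Λ k₂) (trans (cong (n ·_) c≡) (cong (_, + n * unit s) (*-zeroʳ (+ n))))
            image-a-period)))
        (subst (Λ k₂) (cong₂ _,_ (unit-involutive t (+ 2))
            (trans (sym (*-assoc (unit t) (unit s) (+ k₁))) (cong (_* + k₁) (unit-* t s))))
          (Λ-* (unit t) (subst (Λ k₂) (trans (cong₂ (λ c d → k₁ · c ⊕ 2 · d) c≡ d≡)
              (cong₂ _,_ (first (+ k₁) (unit t)) (second (+ k₁) (unit s))))
            image-relation)))
        where
        first : ∀ k t → k * 0ℤ + + 2 * t ≡ t * + 2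
        first = solve-∀
        second : ∀ k s → k * s + + 2 * 0ℤ ≡ s * k
        second = solve-∀
      ... | inj₁ (s , c≡) | inj₁ (t , d≡) = ⊥-elim
        ([ (λ eq → images-distinct (trans c≡ (trans (cong (_, 0ℤ) eq) (sym d≡))))
         , (λ eq → images-not-opposite (trans (cong₂ _⊕_ c≡ d≡) (cong (_, 0ℤ) eq))) ]′
         (units-parallel s t))
      ... | inj₂ (s , c≡) | inj₂ (t , d≡) = ⊥-elim
        ([ (λ eq → images-distinct (trans c≡ (trans (cong (0ℤ ,_) eq) (sym d≡))))
         , (λ eq → images-not-opposite (trans (cong₂ _⊕_ c≡ d≡) (cong (0ℤ ,_) eq))) ]′
         (units-parallel s t))

    -- The exceptional values k₁ = 1 and k₁ = 2.

    -- For k = 1 the generators satisfy a + 2b = 0, so the graph has triangles.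
    ¬lift-1 : ∀ {k} → 2 ℕ.≤ k → 2 ℕ.* k ℕ.≤ n → ¬ Lift 1 k
    ¬lift-1 {k} 2≤k 2k≤n φ
      with adj-to {𝟎} {⟦ b⁺ ⟧} (edge b⁺ (≈-refl ⟦ b⁺ ⟧))
         | adj-to {⟦ b⁺ ⟧} {⟦ b⁺ ⟧ ⊕ ⟦ b⁺ ⟧} (edge b⁺ (≈-refl (⟦ b⁺ ⟧ ⊕ ⟦ b⁺ ⟧)))
         | adj-to {⟦ b⁺ ⟧ ⊕ ⟦ b⁺ ⟧} {𝟎} (edge a⁺ (modΛ (lattice -1ℤ refl (divides 0ℤ refl))))
      where open Lift φ
    ... | edge s b≈s | edge t 2b≈b⊕t | edge u 𝟎≈2b⊕u = no-unit-triangle s t u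
      -- Norm 3 suffices for a triangle, so k = 2 and n = 4 are covered: 3 ≤ k + 1 and 3 < 2 k ≤ n.
      (short⇒𝟎 (s≤s 2≤k) 3<n (ℕₚ.n≤1+n 3) 2k≤n (λ ∣q∣≡4 → ⊥-elim (ℕₚ.<⇒≱ (ℕₚ.n<1+n 3)
          (subst (ℕ._≤ 3) ∣q∣≡4 (ℕₚ.m+n≤o⇒n≤o (∣ proj₁ stu ∣) ‖stu‖≤3))))
        (≈𝟎⇒Λ (≈⊕⇒≈𝟎 (subst (to 𝟎 ≈[ k ]_) collect
          (≈-trans 𝟎≈2b⊕u (⊕-cong (≈-trans 2b≈b⊕t (⊕-cong b≈s (≈-refl ⟦ t ⟧))) (≈-refl ⟦ u ⟧))))))
        ‖stu‖≤3)
      where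
      open Lift φ
      stu = ⟦ s ⟧ ⊕ ⟦ t ⟧ ⊕ ⟦ u ⟧
      3<n : 3 ℕ.< n
      3<n = ℕₚ.≤-trans (ℕₚ.*-monoʳ-≤ 2 2≤k) 2k≤n
      ‖stu‖≤3 : ‖ stu ‖ ℕ.≤ 3
      ‖stu‖≤3 = ℕₚ.≤-trans (‖⊕‖ (⟦ s ⟧ ⊕ ⟦ t ⟧) ⟦ u ⟧)
        (ℕₚ.+-mono-≤ (‖⟦⟧⊕⟦⟧‖ s t) (ℕₚ.≤-reflexive (‖⟦⟧‖ u)))
      collect : to 𝟎 ⊕ ⟦ s ⟧ ⊕ ⟦ t ⟧ ⊕ ⟦ u ⟧ ≡ to 𝟎 ⊕ stu
      collect = trans (cong (_⊕ ⟦ u ⟧) (⊕-assoc (to 𝟎) ⟦ s ⟧ ⟦ t ⟧)) (⊕-assoc (to 𝟎) (⟦ s ⟧ ⊕ ⟦ t ⟧) ⟦ u ⟧)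

    transpose : Dir → Dir
    transpose = spin Sign.+

    -- For k = 2 the generators satisfy 2a + 2b = 0, so two opposite neighbours
    -- x ± c of a vertex x have the second common neighbour x + c + c′, where c′ is
    -- the transpose of c.  For k ≥ 3 the only common neighbour of ± a is 0.
    ¬lift-2 : ∀ {k} → 3 ℕ.≤ k → 2 ℕ.* k ℕ.≤ n → ¬ Lift k 2
    ¬lift-2 {k} 3≤k 2k≤n ψ
      with adj-to {𝟎} {⟦ a⁺ ⟧} (edge a⁺ (≈-refl ⟦ a⁺ ⟧)) | adj-to {𝟎} {⟦ a⁻ ⟧} (edge a⁻ (≈-refl ⟦ a⁻ ⟧))
      where open Lift ψ
    ... | edge c a≈c | edge d a⁻≈d =
      -- As `a⁺` and `a⁻` cancel, both alternatives make w congruent to the image of the origin,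
      -- which puts c + c′, of odd height, into Λ 2.
      odd c ([ contradiction , contradiction ]′ (common-neighbour {k} {a⁺} {a⁻} {𝟎} {from w}
        straight (λ ()) (adj-from (edge c′ toward)) (adj-from (edge (opp c′) away))))
      where
      open Lift ψ
      c′ = transpose c
      w = to 𝟎 ⊕ (⟦ c ⟧ ⊕ ⟦ c′ ⟧)
      -- Here 2 k = n is possible; since the first steps are horizontal, height 4 does not occur.
      not-4 : ∀ s t → ∣ proj₂ ((⟦ a⁺ ⟧ ⊕ ⟦ s ⟧) ⊖ (⟦ a⁻ ⟧ ⊕ ⟦ t ⟧)) ∣ ≢ 4
      not-4 = from-yes (dir? λ s → dir? λ t →
        ¬? (∣ proj₂ ((⟦ a⁺ ⟧ ⊕ ⟦ s ⟧) ⊖ (⟦ a⁻ ⟧ ⊕ ⟦ t ⟧)) ∣ ℕ.≟ 4))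
      straight : RigidAt k a⁺ a⁻
      straight = rigidAt a⁺ a⁻ 3≤k 2k≤n (λ s t eq → ⊥-elim (not-4 s t eq))
      c⊕d≈𝟎 : ⟦ c ⟧ ⊕ ⟦ d ⟧ ≈[ 2 ] 𝟎
      c⊕d≈𝟎 = ≈⊕⇒≈𝟎 (≈-sym ([ (λ l → l) , (λ l → l) ]′
        (to-square ψ {a⁺} {a⁻} {𝟎} {c} {d} straight (λ ()) a≈c a⁻≈d)))
      2c⊕2c′ : ∀ c → Λ 2 ((⟦ c ⟧ ⊕ ⟦ transpose c ⟧) ⊕ (⟦ c ⟧ ⊕ ⟦ transpose c ⟧))
      2c⊕2c′ a⁺ = lattice 1ℤ refl (divides 0ℤ refl)
      2c⊕2c′ b⁺ = lattice 1ℤ refl (divides 0ℤ refl)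
      2c⊕2c′ a⁻ = lattice -1ℤ refl (divides 0ℤ refl)
      2c⊕2c′ b⁻ = lattice -1ℤ refl (divides 0ℤ refl)
      odd : ∀ c → ¬ Λ 2 (⟦ c ⟧ ⊕ ⟦ transpose c ⟧)
      odd a⁺ = Λ-odd refl
      odd b⁺ = Λ-odd refl
      odd a⁻ = Λ-odd refl
      odd b⁻ = Λ-odd refl
      toward : to (from w) ≈[ 2 ] to ⟦ a⁺ ⟧ ⊕ ⟦ c′ ⟧
      toward = ≈-trans (to-from w) (subst (_≈[ 2 ] to ⟦ a⁺ ⟧ ⊕ ⟦ c′ ⟧) (⊕-assoc (to 𝟎) ⟦ c ⟧ ⟦ c′ ⟧)
        (⊕-cong (≈-sym a≈c) (≈-refl ⟦ c′ ⟧)))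
      -- Subtract (c + d) + (c′ + `opp c′`) from 2 c + 2 c′; both lie in Λ 2.
      cc′≈d⊖c′ : ⟦ c ⟧ ⊕ ⟦ c′ ⟧ ≈[ 2 ] ⟦ d ⟧ ⊕ ⟦ opp c′ ⟧
      cc′≈d⊖c′ = Λ⇒≈ (Λ-⊖ (2c⊕2c′ c) (≈𝟎⇒Λ (subst (_≈[ 2 ] 𝟎) (trans (sym (⊕-identityʳ (⟦ c ⟧ ⊕ ⟦ d ⟧)))
        (cong (⟦ c ⟧ ⊕ ⟦ d ⟧ ⊕_) (sym (⟦opp⟧ c′)))) c⊕d≈𝟎))) (regroup ⟦ c ⟧ ⟦ c′ ⟧ ⟦ d ⟧ ⟦ opp c′ ⟧)
        where
        identity : ∀ c e d f → ((c + e) + (c + e)) - ((c + d) + (e + f)) ≡ (c + e) - (d + f)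
        identity = solve-∀
        regroup : ∀ c e d f → ((c ⊕ e) ⊕ (c ⊕ e)) ⊖ ((c ⊕ d) ⊕ (e ⊕ f)) ≡ (c ⊕ e) ⊖ (d ⊕ f)
        regroup (p , q) (p′ , q′) (r , s) (r′ , s′) = cong₂ _,_ (identity p p′ r r′) (identity q q′ s s′)
      away : to (from w) ≈[ 2 ] to ⟦ a⁻ ⟧ ⊕ ⟦ opp c′ ⟧
      away = ≈-trans (to-from w) (≈-trans (⊕-cong (≈-refl (to 𝟎)) cc′≈d⊖c′)
        (subst (_≈[ 2 ] to ⟦ a⁻ ⟧ ⊕ ⟦ opp c′ ⟧) (⊕-assoc (to 𝟎) ⟦ d ⟧ ⟦ opp c′ ⟧)
          (⊕-cong (≈-sym a⁻≈d) (≈-refl ⟦ opp c′ ⟧))))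
      contradiction : from w ≈[ k ] 𝟎 → Λ 2 (⟦ c ⟧ ⊕ ⟦ c′ ⟧)
      contradiction l = ≈𝟎⇒Λ (≈⊕⇒≈𝟎 (≈-trans (≈-sym (to-cong l)) (to-from w)))

    -- Rigidity is asked of the smaller parameter, for which 2 k₁ < 2 k₂ ≤ n is strict even when k₂
    -- = n / 2.
    isomorphic⇒turn : ∀ {k₁ k₂} → 1 ℕ.≤ k₁ → k₁ ℕ.< k₂ → 2 ℕ.* k₂ ℕ.≤ n →
                      Isomorphic n k₁ k₂ → ∃ λ s → Turn (unit s) k₁ k₂
    isomorphic⇒turn {1} _ 1<k₂ 2k₂≤n iso = ⊥-elim (¬lift-1 1<k₂ 2k₂≤n (lift iso))
    isomorphic⇒turn {2} _ 2<k₂ 2k₂≤n iso = ⊥-elim (¬lift-2 2<k₂ 2k₂≤n (Lift-sym (lift iso)))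
    isomorphic⇒turn {k₁@(suc (suc (suc _)))} _ k₁<k₂ 2k₂≤n iso =
      rigid⇒turn (lift iso) (λ e f → rigidAt e f (s≤s (s≤s (s≤s z≤n))) (ℕₚ.<⇒≤ 2k₁<n) (λ _ _ _ → 2k₁<n))
        k₁<k₂ 2k₂≤n
      where
      2k₁<n : 2 ℕ.* k₁ ℕ.< n
      2k₁<n = ℕₚ.<-≤-trans (ℕₚ.*-monoʳ-< 2 k₁<k₂) 2k₂≤n

    arithmetic⇒isomorphic : ∀ {k₁ k₂} s → Arithmetic (unit s) k₁ k₂ → Isomorphic n k₁ k₂
    arithmetic⇒isomorphic s h = descend (turns⇒lift s
      (arithmetic⇒turn (unit² s) h) (arithmetic⇒turn (unit² s) (Arithmetic-sym h)))

-- Translation into residues of naturals.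

open import Data.Nat using (ℕ; _+_; _*_; _/_; _%_; _≤_; _<_; NonZero)
open import Data.Nat.Divisibility using (m%n≡0⇒n∣m; n∣m⇒m%n≡0)
open import Data.Nat.GCD using (gcd)
open import Data.Integer.Divisibility.Signed using (∣⇒∣ᵤ; ∣ᵤ⇒∣)
open import Data.Product using (_×_; _,_)
open import Data.Sign using (Sign)
open import Data.Sum using (_⊎_; inj₁; inj₂)
open import Relation.Binary.PropositionalEquality using (_≡_)
open import Function.Bundles using (_⇔_; mk⇔)
open CayleyGraph using (%≡⇒∣; ∣⇒%≡; module Accordion)

theorem2p3 : (n k₁ k₂ : ℕ) → .{{_ : NonZero n}} →
    3 ≤ n → 1 ≤ k₁ → k₁ < k₂ → 2 * k₂ ≤ n →
    Isomorphic n k₁ k₂ ⇔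
    ((gcd n k₁ ≡ 2 × gcd n k₂ ≡ 2) ×
    (((k₁ * k₂) / 2) % n ≡ 2 % n ⊎ ((k₁ * k₂) / 2 + 2) % n ≡ 0))
theorem2p3 n k₁ k₂ _ 1≤k₁ k₁<k₂ 2k₂≤n = mk⇔ only-if if
  where
  open Accordion n
  half = (k₁ * k₂) / 2
  congruence : ∀ s → Arithmetic (unit s) k₁ k₂ →
               (gcd n k₁ ≡ 2 × gcd n k₂ ≡ 2) × (half % n ≡ 2 % n ⊎ (half + 2) % n ≡ 0)
  congruence Sign.+ (arithmetic gcd₁ gcd₂ n∣half-2) =
    (gcd₁ , gcd₂) , inj₁ (∣⇒%≡ n half 2 n∣half-2)
  -- For the sign -, subtracting -1 times 2 computes to `half + 2`.
  congruence Sign.- (arithmetic gcd₁ gcd₂ n∣half+2) =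
    (gcd₁ , gcd₂) , inj₂ (n∣m⇒m%n≡0 (half + 2) n (∣⇒∣ᵤ n∣half+2))
  only-if : Isomorphic n k₁ k₂ →
            (gcd n k₁ ≡ 2 × gcd n k₂ ≡ 2) × (half % n ≡ 2 % n ⊎ (half + 2) % n ≡ 0)
  only-if iso = let s , h = isomorphic⇒turn 1≤k₁ k₁<k₂ 2k₂≤n iso in
    congruence s (turn⇒arithmetic (unit² s) h)
  if : (gcd n k₁ ≡ 2 × gcd n k₂ ≡ 2) × (half % n ≡ 2 % n ⊎ (half + 2) % n ≡ 0) →
       Isomorphic n k₁ k₂
  if ((gcd₁ , gcd₂) , inj₁ eq) =
    arithmetic⇒isomorphic Sign.+ (arithmetic gcd₁ gcd₂ (%≡⇒∣ n half 2 eq))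
  if ((gcd₁ , gcd₂) , inj₂ eq) =
    arithmetic⇒isomorphic Sign.- (arithmetic gcd₁ gcd₂ (∣ᵤ⇒∣ (m%n≡0⇒n∣m (half + 2) n eq)))
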